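{- Let $t,k,v$ be integers with $0<t<k<v$, and for $0 \le i \le t$ put $s_i = 2^{t+1}-2^{t-i}$. For every $i \in \{0,1,\ldots,t-1\}$ and every integer $s$ with $s_i < s < s_{i+1}$ (that is, $2^{t+1}-2^{t-i} < s < 2^{t+1}-2^{t-i-1}$), there does not exist any Steiner $t$-$(v,k)$ trade of volume $s$.
   Context: Let $0<t<k<v$ be natural numbers and let $X$ be a set with $v$ elements. For $0 \le j \le v$, $P_j(X)$ denotes the set of all $j$-element subsets of $X$; elements of $P_k(X)$ are called blocks. A $t$-$(v,k)$ trade $T=\{T_1,T_2\}$ consists of two disjoint collections $T_1,T_2$ of blocks (repeated blocks within $T_1$ or within $T_2$ are allowed in general, i.e. they are finite multisets with no common block) such that every element of $P_t(X)$ is contained in the same number of blocks of $T_1$ as of $T_2$ (counted with multiplicity). Then $|T_1|=|T_2|$, and this common number is called the volume of $T$. A $t$-$(v,k)$ trade is called a Steiner $t$-$(v,k)$ trade if every element of $P_t(X)$ is contained in at most one block of $T_1$ and in at most one block of $T_2$. -}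

module Defs where

open import Data.Fin.Subset using (Subset; ∣_∣)
open import Data.Fin.Subset.Properties using (_⊆?_)
open import Data.List.Base using (List; length; filter)
open import Data.List.Relation.Binary.Disjoint.Propositional using (Disjoint)
open import Data.List.Relation.Unary.All using (All)
open import Data.Nat.Base using (ℕ; _+_; _∸_; _^_; _≤_)
open import Data.Product.Base using (_×_)
open import Relation.Binary.PropositionalEquality.Core using (_≡_)

-- The v-element set X is Fin v; P j is the predicate on its subsets
-- that cuts out P_j(X).
P : (j : ℕ) {v : ℕ} → Subset v → Set
P j B = ∣ B ∣ ≡ j

-- A finite multiset of subsets of X is represented by a list of them:
-- repetitions count, and no notion below depends on the order.
Collection : ℕ → Set
Collection v = List (Subset v)

-- The number of members of C, with multiplicity, that contain A.
degree : ∀ {v} → Subset v → Collection v → ℕ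
degree A C = length (filter (A ⊆?_) C)

record Trade (t k v : ℕ) : Set where
  field
    T₁ T₂    : Collection v
    blocks₁  : All (P k) T₁
    blocks₂  : All (P k) T₂
    disjoint : Disjoint T₁ T₂
    balanced : ∀ (A : Subset v) → P t A → degree A T₁ ≡ degree A T₂

-- For t ≤ k, counting pairs (A , B) with A ∈ P_t(X), A ⊆ B and B a block
-- shows length T₁ ≡ length T₂, so the choice of T₁ here is immaterial.
volume : ∀ {t k v} → Trade t k v → ℕ
volume T = length (Trade.T₁ T)

IsSteiner : ∀ {t k v} → Trade t k v → Set
IsSteiner {t} {k} {v} T =
  ∀ (A : Subset v) → P t A → degree A T₁ ≤ 1 × degree A T₂ ≤ 1
  where open Trade T

-- s_i = 2^{t+1} - 2^{t-i}. For i ≤ t neither subtraction truncates.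
s[_,_] : (t i : ℕ) → ℕ
s[ t , i ] = 2 ^ (t + 1) ∸ 2 ^ (t ∸ i)

{-# OPTIONS --safe #-}
module Submission where

-- Over 𝔽₂ the blocks of a Steiner t-(v,k) trade of volume m form a set of 2m points of the v-cube that is
-- orthogonal to all polynomials of degree at most t, that is, a word f of the Reed–Muller code of minimum
-- distance q = 2 ^ (t + 1).  The weights of such words below 2q have the form 2q − 2 ^ e (Kasami–Tokura),
-- and no such number is twice a volume strictly between two consecutive s_i.
--
-- To find the weights, choose t + 1 affine functions whose fibres all meet f in an odd set.  The sums over these
-- sets form a flat L of size q, and if wt f < 2q then L meets f in more than q / 2 points, so that f + L is
-- lighter than f.  By induction on the weight, f is a sum of at most two flats of size q, or is supported
-- on a flat M of size 4q.  In the first case the weight is read off the intersection of the two flats, whose size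
-- is a power of two.  In the second case f meets its translate by a direction u of M in wt f or wt f − q points;
-- summing over u gives (2q − wt f)² = q ρ, where ρ is the order of the group of translations fixing f.

-- The induction does not close by itself: adding `L` back to a sum of two flats gives three flats,
-- and adding it back to a word on `M` may leave `M`. Both obstacles are overcome by counting, since
-- flats meet in no point or in a power of two of points. If three flats of size q have a sum
-- lighter than 2q, then either two of them meet in at least half of their points, and their sum is
-- again a flat or empty, or one flat meets both others in exactly a quarter. In the latter case, if
-- the three have no common point, they can be regrouped as two; if they have one, all intersection
-- sizes are forced and the three lie in a flat of size 4q, which is where the second case begins.
-- For a lighter word g on `M`, the weights leave only the sizes q and q / 2 for the intersection of
-- `L` and `M`. The size q / 2 is impossible: g would miss some points of this intersection, but
-- fewer than a quarter, whereas g is quadratic there. The Steiner condition makes the blocks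
-- distinct, so none cancel over 𝔽₂ and the weight is twice the volume.

open import Defs
open import Data.Bool.Base using (Bool; true; false; not; _∧_; _xor_)
open import Data.Bool.Properties using (xor-comm; xor-assoc; xor-same; not-involutive; xor-identityʳ; ∧-zeroʳ;
    ∧-comm; ∧-assoc; ∧-distribʳ-xor; ∧-identityʳ; ¬-not)
  renaming (_≟_ to _≟ᵇ_)
open import Data.Empty using (⊥; ⊥-elim)
open import Data.Fin.Base using (Fin; zero; suc)
open import Data.Fin.Subset using (Subset; ∣_∣; ⁅_⁆)
open import Data.Fin.Subset.Properties using (_⊆?_)
open import Data.List.Base using ([]; _∷_; length; _++_)
open import Data.List.Membership.Propositional using (_∈_)
open import Data.List.Properties using (length-++)
open import Data.List.Relation.Unary.All as List using ([]; _∷_)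
open import Data.List.Relation.Unary.AllPairs using ([]; _∷_)
open import Data.List.Relation.Unary.Any using (here; there)
open import Data.List.Relation.Unary.Unique.Propositional using (Unique)
open import Data.List.Relation.Unary.Unique.Propositional.Properties using (++⁺)
open import Data.Nat.Base using (ℕ; zero; suc; NonZero; >-nonZero; _+_; _*_; _∸_; _^_; _≤_; _<_; z≤n; s≤s)
open import Data.Nat.Divisibility using (_∣_; divides; m∣m*n)
open import Data.Nat.Primality using (prime[2]; euclidsLemma)
open import Data.Nat.Properties
open import Data.Nat.Tactic.RingSolver using (solve-∀)
open import Data.Product.Base using (Σ-syntax; ∃-syntax; _×_; _,_; proj₁; proj₂)
open import Data.Sum.Base using (_⊎_; inj₁; inj₂)
open import Data.Unit.Base using (⊤; tt)
open import Data.Vec.Base using (Vec; []; _∷_; zipWith; replicate; lookup; tabulate; map; head; tail; _[_]≔_)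
open import Data.Vec.Properties using (≡-dec; lookup-zipWith; lookup∘tabulate; tabulate∘lookup; tabulate-cong;
    zipWith-comm; zipWith-assoc; zipWith-identityʳ)
open import Data.Vec.Relation.Unary.All using (All; []; _∷_)
open import Function.Base using (_∘_)
open import Relation.Binary.PropositionalEquality using
    (_≡_; _≢_; _≗_; refl; sym; trans; cong; cong₂; subst; subst₂; module ≡-Reasoning)
open import Relation.Nullary.Decidable using (Dec; does; yes; no; dec-true; dec-false)
open import Relation.Nullary.Negation.Core using (¬_)

-- Linear arithmetic by certificates: x ≤ y is a sum of multiples of the hypotheses,
-- and the identity is left to the ring solver.

lin≤ : ∀ {x y a b} k → x ≤ y → a + y + k ≡ b + x → a ≤ b
lin≤ {x} {y} {a} {b} k x≤y e = +-cancelʳ-≤ y a b (begin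
  a + y     ≤⟨ m≤m+n (a + y) k ⟩
  a + y + k ≡⟨ e ⟩
  b + x     ≤⟨ +-monoʳ-≤ b x≤y ⟩
  b + y     ∎)
  where open ≤-Reasoning

lin⊥ : ∀ {x y} k → x ≤ y → x ≡ suc (y + k) → ⊥
lin⊥ {x} {y} k x≤y e = <-irrefl refl (≤-trans (≤-trans (s≤s (m≤m+n y k)) (≤-reflexive (sym e))) x≤y)

-- The group of the cube

infixl 6 _⊞_
_⊞_ : ∀ {n} → Vec Bool n → Vec Bool n → Vec Bool n
_⊞_ = zipWith _xor_

𝟎 : ∀ {n} → Vec Bool n
𝟎 = replicate _ false

⊞-comm : ∀ {n} (x y : Vec Bool n) → x ⊞ y ≡ y ⊞ x
⊞-comm = zipWith-comm xor-comm

⊞-assoc : ∀ {n} (x y z : Vec Bool n) → x ⊞ y ⊞ z ≡ x ⊞ (y ⊞ z)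
⊞-assoc = zipWith-assoc xor-assoc

⊞-self : ∀ {n} (x : Vec Bool n) → x ⊞ x ≡ 𝟎
⊞-self [] = refl
⊞-self (a ∷ x) = cong₂ _∷_ (xor-same a) (⊞-self x)

⊞-idʳ : ∀ {n} (x : Vec Bool n) → x ⊞ 𝟎 ≡ x
⊞-idʳ = zipWith-identityʳ xor-identityʳ

-- A reflective solver for identities in the group

infixl 6 _⊕_
data Expr (k : ℕ) : Set where
  var : Fin k → Expr k
  _⊕_ : Expr k → Expr k → Expr k

⟦_⟧ : ∀ {k n} → Expr k → Vec (Vec Bool n) k → Vec Bool n
⟦ var i ⟧ ρ = lookup ρ i
⟦ s ⊕ t ⟧ ρ = ⟦ s ⟧ ρ ⊞ ⟦ t ⟧ ρ

normalise : ∀ {k} → Expr k → Vec Bool k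
normalise (var i) = ⁅ i ⁆
normalise (s ⊕ t) = normalise s ⊞ normalise t

combination : ∀ {k n} → Vec Bool k → Vec (Vec Bool n) k → Vec Bool n
combination [] [] = 𝟎
combination (true  ∷ c) (x ∷ ρ) = x ⊞ combination c ρ
combination (false ∷ c) (x ∷ ρ) = combination c ρ

combination-𝟎 : ∀ {k n} (ρ : Vec (Vec Bool n) k) → combination 𝟎 ρ ≡ 𝟎
combination-𝟎 [] = refl
combination-𝟎 (x ∷ ρ) = combination-𝟎 ρ

combination-⁅⁆ : ∀ {k n} (i : Fin k) (ρ : Vec (Vec Bool n) k) → combination ⁅ i ⁆ ρ ≡ lookup ρ i
combination-⁅⁆ zero (x ∷ ρ) = trans (cong (x ⊞_) (combination-𝟎 ρ)) (⊞-idʳ x)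
combination-⁅⁆ (suc i) (x ∷ ρ) = combination-⁅⁆ i ρ

combination-⊞ : ∀ {k n} (c d : Vec Bool k) (ρ : Vec (Vec Bool n) k) →
  combination (c ⊞ d) ρ ≡ combination c ρ ⊞ combination d ρ
combination-⊞ [] [] [] = sym (⊞-self 𝟎)
combination-⊞ (false ∷ c) (false ∷ d) (x ∷ ρ) = combination-⊞ c d ρ
combination-⊞ (true ∷ c) (false ∷ d) (x ∷ ρ) =
  trans (cong (x ⊞_) (combination-⊞ c d ρ)) (sym (⊞-assoc x _ _))
combination-⊞ (false ∷ c) (true ∷ d) (x ∷ ρ) = begin
  x ⊞ combination (c ⊞ d) ρ  ≡⟨ cong (x ⊞_) (trans (combination-⊞ c d ρ) (⊞-comm _ _)) ⟩
  x ⊞ (q ⊞ p)                ≡⟨ ⊞-assoc x q p ⟨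
  x ⊞ q ⊞ p                  ≡⟨ ⊞-comm _ p ⟩
  p ⊞ (x ⊞ q)                ∎
  where
  open ≡-Reasoning
  p = combination c ρ
  q = combination d ρ
combination-⊞ (true ∷ c) (true ∷ d) (x ∷ ρ) = begin
  combination (c ⊞ d) ρ      ≡⟨ combination-⊞ c d ρ ⟩
  p ⊞ q                      ≡⟨ cong (_⊞ q) (⊞-idʳ p) ⟨
  p ⊞ 𝟎 ⊞ q                  ≡⟨ cong (λ z → p ⊞ z ⊞ q) (⊞-self x) ⟨
  p ⊞ (x ⊞ x) ⊞ q            ≡⟨ cong (_⊞ q) (⊞-assoc p x x) ⟨
  p ⊞ x ⊞ x ⊞ q              ≡⟨ ⊞-assoc (p ⊞ x) x q ⟩
  p ⊞ x ⊞ (x ⊞ q)            ≡⟨ cong (_⊞ (x ⊞ q)) (⊞-comm p x) ⟩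
  x ⊞ p ⊞ (x ⊞ q)            ∎
  where
  open ≡-Reasoning
  p = combination c ρ
  q = combination d ρ

normalise-correct : ∀ {k n} (s : Expr k) (ρ : Vec (Vec Bool n) k) →
  combination (normalise s) ρ ≡ ⟦ s ⟧ ρ
normalise-correct (var i) ρ = combination-⁅⁆ i ρ
normalise-correct (s ⊕ t) ρ =
  trans (combination-⊞ (normalise s) (normalise t) ρ)
        (cong₂ _⊞_ (normalise-correct s ρ) (normalise-correct t ρ))

-- An expression is determined by its coefficient vector over 𝔽₂. For closed expressions these
-- vectors compute, so the premise is always met by `refl`.
⊞-solve : ∀ {k n} (ρ : Vec (Vec Bool n) k) (s t : Expr k) → normalise s ≡ normalise t →
  ⟦ s ⟧ ρ ≡ ⟦ t ⟧ ρ
⊞-solve ρ s t e = trans (sym (normalise-correct s ρ))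
  (trans (cong (λ c → combination c ρ) e) (normalise-correct t ρ))

x₀ : ∀ {k} → Expr (1 + k)
x₀ = var zero
x₁ : ∀ {k} → Expr (2 + k)
x₁ = var (suc zero)
x₂ : ∀ {k} → Expr (3 + k)
x₂ = var (suc (suc zero))
x₃ : ∀ {k} → Expr (4 + k)
x₃ = var (suc (suc (suc zero)))

⊞-cancelʳ : ∀ {n} (x u : Vec Bool n) → x ⊞ u ⊞ u ≡ x
⊞-cancelʳ x u = ⊞-solve (x ∷ u ∷ []) (x₀ ⊕ x₁ ⊕ x₁) x₀ refl

-- Sums over the cube

∑ : ∀ {n} → (Vec Bool n → ℕ) → ℕ
∑ {zero}  F = F []
∑ {suc n} F = ∑ (F ∘ (false ∷_)) + ∑ (F ∘ (true ∷_))

∑-cong : ∀ {n} {F H : Vec Bool n → ℕ} → F ≗ H → ∑ F ≡ ∑ H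
∑-cong {zero} e = e []
∑-cong {suc n} e = cong₂ _+_ (∑-cong (e ∘ (false ∷_))) (∑-cong (e ∘ (true ∷_)))

∑-mono : ∀ {n} {F H : Vec Bool n → ℕ} → (∀ x → F x ≤ H x) → ∑ F ≤ ∑ H
∑-mono {zero} e = e []
∑-mono {suc n} e = +-mono-≤ (∑-mono (e ∘ (false ∷_))) (∑-mono (e ∘ (true ∷_)))

∑-0 : ∀ {n} → ∑ {n} (λ _ → 0) ≡ 0
∑-0 {zero} = refl
∑-0 {suc n} = cong₂ _+_ (∑-0 {n}) (∑-0 {n})

+-interchange : ∀ a b c d → (a + b) + (c + d) ≡ (a + c) + (b + d)
+-interchange = solve-∀

∑-+ : ∀ {n} (F H : Vec Bool n → ℕ) → ∑ (λ x → F x + H x) ≡ ∑ F + ∑ H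
∑-+ {zero} F H = refl
∑-+ {suc n} F H = trans (cong₂ _+_ (∑-+ (F ∘ (false ∷_)) (H ∘ (false ∷_))) (∑-+ (F ∘ (true ∷_)) (H ∘ (true ∷_))))
  (+-interchange (∑ (F ∘ (false ∷_))) _ _ _)

∑-* : ∀ {n} c (F : Vec Bool n → ℕ) → ∑ (λ x → c * F x) ≡ c * ∑ F
∑-* {zero} c F = refl
∑-* {suc n} c F = trans (cong₂ _+_ (∑-* c (F ∘ (false ∷_))) (∑-* c (F ∘ (true ∷_))))
    (sym (*-distribˡ-+ c (∑ (F ∘ (false ∷_))) _))

∑-const : ∀ n c → ∑ {n} (λ _ → c) ≡ c * 2 ^ n
∑-const zero c = sym (*-identityʳ c)
∑-const (suc n) c = trans (cong₂ _+_ (∑-const n c) (∑-const n c)) (dbl c (2 ^ n))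
  where
  dbl : ∀ c q → c * q + c * q ≡ c * (2 * q)
  dbl = solve-∀

∑-swap : ∀ {m n} (F : Vec Bool m → Vec Bool n → ℕ) →
  ∑ (λ x → ∑ (λ y → F x y)) ≡ ∑ (λ y → ∑ (λ x → F x y))
∑-swap {zero} F = refl
∑-swap {suc m} F = trans (cong₂ _+_ (∑-swap (F ∘ (false ∷_))) (∑-swap (F ∘ (true ∷_))))
  (sym (∑-+ (λ y → ∑ (λ x → F (false ∷ x) y)) _))

∑-shift : ∀ {n} (u : Vec Bool n) (F : Vec Bool n → ℕ) → ∑ (λ x → F (x ⊞ u)) ≡ ∑ F
∑-shift [] F = refl
∑-shift (false ∷ u) F = cong₂ _+_ (∑-shift u (F ∘ (false ∷_))) (∑-shift u (F ∘ (true ∷_)))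
∑-shift (true ∷ u) F = trans (cong₂ _+_ (∑-shift u (F ∘ (true ∷_))) (∑-shift u (F ∘ (false ∷_))))
  (+-comm (∑ (F ∘ (true ∷_))) _)

-- Boolean functions on the cube and their weights

Fun : ℕ → Set
Fun n = Vec Bool n → Bool

infixl 6 _+ᶠ_
infixl 7 _∧ᶠ_
_+ᶠ_ _∧ᶠ_ : ∀ {n} → Fun n → Fun n → Fun n
(f +ᶠ g) x = f x xor g x
(f ∧ᶠ g) x = f x ∧ g x

¬ᶠ : ∀ {n} → Fun n → Fun n
¬ᶠ f x = not (f x)

shift : ∀ {n} → Vec Bool n → Fun n → Fun n
shift u f x = f (x ⊞ u)

𝟙 : Bool → ℕ
𝟙 true = 1
𝟙 false = 0

wt : ∀ {n} → Fun n → ℕ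
wt f = ∑ (𝟙 ∘ f)

wt-cong : ∀ {n} {f g : Fun n} → f ≗ g → wt f ≡ wt g
wt-cong e = ∑-cong (cong 𝟙 ∘ e)

wt-shift : ∀ {n} u (f : Fun n) → wt (shift u f) ≡ wt f
wt-shift u f = ∑-shift u (𝟙 ∘ f)

𝟙-mono : ∀ {a b} → (a ≡ true → b ≡ true) → 𝟙 a ≤ 𝟙 b
𝟙-mono {false} h = z≤n
𝟙-mono {true} h rewrite h refl = ≤-refl

wt-mono : ∀ {n} {f g : Fun n} → (∀ x → f x ≡ true → g x ≡ true) → wt f ≤ wt g
wt-mono h = ∑-mono (λ x → 𝟙-mono (h x))

search : ∀ {n} (f : Fun n) → (∃[ x ] f x ≡ true) ⊎ (∀ x → f x ≡ false)
search {zero} f with f [] in e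
... | true = inj₁ ([] , e)
... | false = inj₂ (λ { [] → e })
search {suc n} f with search (f ∘ (false ∷_)) | search (f ∘ (true ∷_))
... | inj₁ (x , e) | _ = inj₁ (_ , e)
... | inj₂ _ | inj₁ (x , e) = inj₁ (_ , e)
... | inj₂ e₀ | inj₂ e₁ = inj₂ (λ { (false ∷ x) → e₀ x ; (true ∷ x) → e₁ x })

wt-empty : ∀ {n} {f : Fun n} → (∀ x → f x ≡ false) → wt f ≡ 0
wt-empty {n} e = trans (wt-cong e) (∑-0 {n})

term≤∑ : ∀ {n} (F : Vec Bool n → ℕ) x → F x ≤ ∑ F
term≤∑ F [] = ≤-refl
term≤∑ F (false ∷ x) = ≤-trans (term≤∑ (F ∘ (false ∷_)) x) (m≤m+n _ _)
term≤∑ F (true ∷ x) = ≤-trans (term≤∑ (F ∘ (true ∷_)) x) (m≤n+m _ _)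

wt-point : ∀ {n} {f : Fun n} {x} → f x ≡ true → 1 ≤ wt f
wt-point {f = f} {x} e = subst (λ b → 𝟙 b ≤ wt f) e (term≤∑ (𝟙 ∘ f) x)

wt-pos : ∀ {n} {f : Fun n} → 1 ≤ wt f → ∃[ x ] f x ≡ true
wt-pos {f = f} p with search f
... | inj₁ r = r
... | inj₂ e with () ← ≤-trans p (≤-reflexive (wt-empty e))

wt-+ : ∀ {n} (f g : Fun n) → wt (f +ᶠ g) + 2 * wt (f ∧ᶠ g) ≡ wt f + wt g
wt-+ f g = begin
  wt (f +ᶠ g) + 2 * wt (f ∧ᶠ g)                  ≡⟨ cong (wt (f +ᶠ g) +_) (∑-* 2 (𝟙 ∘ (f ∧ᶠ g))) ⟨
  wt (f +ᶠ g) + ∑ (λ x → 2 * 𝟙 (f x ∧ g x))      ≡⟨ ∑-+ (𝟙 ∘ (f +ᶠ g)) _ ⟨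
  ∑ (λ x → 𝟙 (f x xor g x) + 2 * 𝟙 (f x ∧ g x))  ≡⟨ ∑-cong (λ x → pt (f x) (g x)) ⟩
  ∑ (λ x → 𝟙 (f x) + 𝟙 (g x))                    ≡⟨ ∑-+ (𝟙 ∘ f) (𝟙 ∘ g) ⟩
  wt f + wt g                                    ∎
  where
  open ≡-Reasoning
  pt : ∀ a b → 𝟙 (a xor b) + 2 * 𝟙 (a ∧ b) ≡ 𝟙 a + 𝟙 b
  pt true true = refl
  pt true false = refl
  pt false true = refl
  pt false false = refl

wt-split : ∀ {n} (f g : Fun n) → wt (f ∧ᶠ g) + wt (f ∧ᶠ ¬ᶠ g) ≡ wt f
wt-split f g = trans (sym (∑-+ (𝟙 ∘ (f ∧ᶠ g)) _)) (∑-cong (λ x → pt (f x) (g x)))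
  where
  pt : ∀ a b → 𝟙 (a ∧ b) + 𝟙 (a ∧ not b) ≡ 𝟙 a
  pt true true = refl
  pt true false = refl
  pt false b = refl

wt-⊆-≥ : ∀ {n} {f g : Fun n} → (∀ x → f x ≡ true → g x ≡ true) → wt g ≤ wt f →
  ∀ x → g x ≡ true → f x ≡ true
wt-⊆-≥ {f = f} {g} f⊆g g≤f x gx with f x in fx
... | true = refl
... | false = ⊥-elim (<⇒≱ missing (+-cancelˡ-≤ (wt (g ∧ᶠ f)) _ 0 (begin
  wt (g ∧ᶠ f) + wt (g ∧ᶠ ¬ᶠ f)  ≡⟨ wt-split g f ⟩
  wt g                          ≤⟨ g≤f ⟩
  wt f                          ≤⟨ wt-mono (λ y fy → cong₂ _∧_ (f⊆g y fy) fy) ⟩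
  wt (g ∧ᶠ f)                   ≡⟨ +-identityʳ _ ⟨
  wt (g ∧ᶠ f) + 0               ∎)))
  where
  open ≤-Reasoning
  missing : 1 ≤ wt (g ∧ᶠ ¬ᶠ f)
  missing = wt-point {x = x} (cong₂ _∧_ gx (cong not fx))

-- Parity of weights

odd : ℕ → Bool
odd zero = false
odd (suc m) = not (odd m)

odd-+ : ∀ m n → odd (m + n) ≡ odd m xor odd n
odd-+ zero n = refl
odd-+ (suc m) n = trans (cong not (odd-+ m n)) (pt (odd m) (odd n))
  where
  pt : ∀ a b → not (a xor b) ≡ not a xor b
  pt true b = not-involutive b
  pt false b = refl

odd-2* : ∀ m → odd (2 * m) ≡ false
odd-2* m = trans (cong (λ t → odd (m + t)) (+-identityʳ m)) (trans (odd-+ m m) (xor-same (odd m)))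

par : ∀ {n} → Fun n → Bool
par f = odd (wt f)

par-cong : ∀ {n} {f g : Fun n} → f ≗ g → par f ≡ par g
par-cong e = cong odd (wt-cong e)

par-+ : ∀ {n} (f g : Fun n) → par (f +ᶠ g) ≡ par f xor par g
par-+ f g = begin
  par (f +ᶠ g)                            ≡⟨ xor-identityʳ _ ⟨
  par (f +ᶠ g) xor false                  ≡⟨ cong (par (f +ᶠ g) xor_) (odd-2* (wt (f ∧ᶠ g))) ⟨
  par (f +ᶠ g) xor odd (2 * wt (f ∧ᶠ g))  ≡⟨ odd-+ (wt (f +ᶠ g)) _ ⟨
  odd (wt (f +ᶠ g) + 2 * wt (f ∧ᶠ g))     ≡⟨ cong odd (wt-+ f g) ⟩
  odd (wt f + wt g)                       ≡⟨ odd-+ (wt f) (wt g) ⟩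
  par f xor par g                         ∎
  where open ≡-Reasoning

-- Affine functions and flats

-- Over 𝔽₂ the sums of three points generate all affine combinations, so neither a base point nor a
-- linear part has to be named.
record Affine {n} (h : Fun n) : Set where
  constructor affine
  field at-sum : ∀ x y z → h (x ⊞ y ⊞ z) ≡ h x xor h y xor h z
open Affine

-- The empty set counts as a flat; where this matters a point is supplied separately.
record Flat {n} (F : Fun n) : Set where
  constructor flat
  field closed : ∀ {x y z} → F x ≡ true → F y ≡ true → F z ≡ true → F (x ⊞ y ⊞ z) ≡ true
open Flat

affine-const : ∀ {n} b → Affine {n} (λ _ → b)
affine-const true = affine (λ _ _ _ → refl)
affine-const false = affine (λ _ _ _ → refl)

xor-interchange : ∀ a b c d → (a xor b) xor (c xor d) ≡ (a xor c) xor (b xor d)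
-- Bits are treated as vectors of length one, so that the group solver applies.
xor-interchange a b c d = cong head
  (⊞-solve ((a ∷ []) ∷ (b ∷ []) ∷ (c ∷ []) ∷ (d ∷ []) ∷ []) (x₀ ⊕ x₁ ⊕ (x₂ ⊕ x₃)) (x₀ ⊕ x₂ ⊕ (x₁ ⊕ x₃)) refl)

affine-+ : ∀ {n} {g h : Fun n} → Affine g → Affine h → Affine (g +ᶠ h)
affine-+ {g = g} {h} ag ah = affine λ x y z → begin
  g (x ⊞ y ⊞ z) xor h (x ⊞ y ⊞ z)                  ≡⟨ cong₂ _xor_ (at-sum ag x y z) (at-sum ah x y z) ⟩
  (g x xor g y xor g z) xor (h x xor h y xor h z)  ≡⟨ xor-interchange (g x) _ (h x) _ ⟩
  (g x xor h x) xor ((g y xor g z) xor (h y xor h z)) ≡⟨ cong ((g x xor h x) xor_) (xor-interchange (g y) _ (h y) _) ⟩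
  (g x xor h x) xor (g y xor h y) xor (g z xor h z)   ∎
  where open ≡-Reasoning

affine-not : ∀ {n} {h : Fun n} → Affine h → Affine (¬ᶠ h)
affine-not = affine-+ (affine-const true)

affine-shift : ∀ {n} {h : Fun n} u → Affine h → Affine (shift u h)
affine-shift {h = h} u ah = affine λ x y z → trans
  (cong h (⊞-solve (x ∷ y ∷ z ∷ u ∷ []) (x₀ ⊕ x₁ ⊕ x₂ ⊕ x₃) (x₀ ⊕ x₃ ⊕ (x₁ ⊕ x₃) ⊕ (x₂ ⊕ x₃)) refl))
  (at-sum ah (x ⊞ u) (y ⊞ u) (z ⊞ u))

affine-⊞ : ∀ {n} {h : Fun n} → Affine h → ∀ x u → h (x ⊞ u) ≡ h x xor (h u xor h 𝟎)
affine-⊞ {h = h} ah x u = trans (cong h (sym (⊞-idʳ (x ⊞ u)))) (at-sum ah x u 𝟎)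

-- I s is the Reed–Muller code of order n ∸ s on the n-cube, described as a dual code:
-- membership says that f is orthogonal to all products of fewer than s affine functions.
I : ∀ {n} → ℕ → Fun n → Set
I zero f = ⊤
I (suc s) f = par f ≡ false × (∀ h → Affine h → I s (f ∧ᶠ h))

I-cong : ∀ {n} s {f g : Fun n} → f ≗ g → I s f → I s g
I-cong zero e _ = tt
I-cong (suc s) e (p , k) = trans (sym (par-cong e)) p , λ h ah → I-cong s (λ x → cong (_∧ h x) (e x)) (k h ah)

I-0 : ∀ {n} s {f : Fun n} → (∀ x → f x ≡ false) → I s f
I-0 zero e = tt
I-0 (suc s) e = cong odd (wt-empty e) , λ h _ → I-0 s (λ x → cong (_∧ h x) (e x))

I-+ : ∀ {n} s {f g : Fun n} → I s f → I s g → I s (f +ᶠ g)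
I-+ zero _ _ = tt
I-+ (suc s) {f} {g} (p , k) (p′ , k′) =
  trans (par-+ f g) (cong₂ _xor_ p p′) ,
  λ h ah → I-cong s (λ x → sym (∧-distribʳ-xor (h x) (f x) (g x))) (I-+ s (k h ah) (k′ h ah))

I-scale : ∀ {n} s b {f : Fun n} → I s f → I s (λ x → b ∧ f x)
I-scale s true i = i
I-scale s false i = I-0 s (λ _ → refl)

I-pred : ∀ {n} s {f : Fun n} → I (suc s) f → I s f
I-pred zero _ = tt
I-pred (suc s) (p , k) = p , λ h ah → I-pred s (k h ah)

I-shift : ∀ {n} s {f : Fun n} u → I s f → I s (shift u f)
I-shift zero u _ = tt
I-shift (suc s) {f} u (p , k) = trans (cong odd (wt-shift u f)) p ,
  λ h ah → I-cong s (λ x → cong (λ y → f (x ⊞ u) ∧ h y) (⊞-cancelʳ x u))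
    (I-shift s u (k (shift u h) (affine-shift u ah)))

D : ∀ {n} → Vec Bool n → Fun n → Fun n
D u f = f +ᶠ shift u f

-- Differentiation lowers the degree by one. A translate has the same weight, so the parity
-- vanishes. Along `u` the function `h` changes by the constant `h u xor h 𝟎`; hence `D u f ∧ᶠ h` is
-- the derivative of `f ∧ᶠ h` plus a multiple of a translate of `f`, and the induction applies.
I-D : ∀ {n} s {f : Fun n} u → I s f → I (suc s) (D u f)
I-D s {f} u i = trans (par-+ f (shift u f)) (trans (cong (λ w → par f xor odd w) (wt-shift u f))
    (xor-same (par f))) , I-D∧ s i
  where
  I-D∧ : ∀ s → I s f → ∀ h → Affine h → I s (D u f ∧ᶠ h)
  I-D∧ zero _ h ah = tt
  I-D∧ (suc s) i@(_ , k) h ah = I-cong (suc s) e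
    (I-+ (suc s) (I-D s u (k h ah)) (I-scale (suc s) (h u xor h 𝟎) (I-shift (suc s) u i)))
    where
    pt : ∀ a b c d → ((a ∧ c) xor (b ∧ (c xor d))) xor (d ∧ b) ≡ (a xor b) ∧ c
    pt true true true true = refl
    pt true true true false = refl
    pt true true false true = refl
    pt true true false false = refl
    pt true false true true = refl
    pt true false true false = refl
    pt true false false true = refl
    pt true false false false = refl
    pt false true true true = refl
    pt false true true false = refl
    pt false true false true = refl
    pt false true false false = refl
    pt false false c true = refl
    pt false false c false = refl
    e : (D u (f ∧ᶠ h) +ᶠ (λ x → (h u xor h 𝟎) ∧ f (x ⊞ u))) ≗ (D u f ∧ᶠ h)
    e x = trans (cong (λ t → ((f x ∧ h x) xor (f (x ⊞ u) ∧ t)) xor ((h u xor h 𝟎) ∧ f (x ⊞ u))) (affine-⊞ ah x u))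
      (pt (f x) (f (x ⊞ u)) (h x) (h u xor h 𝟎))

∧-true : ∀ {a b} → a ≡ true → b ≡ true → a ∧ b ≡ true
∧-true refl refl = refl

∧-trueˡ : ∀ {a b} → a ∧ b ≡ true → a ≡ true
∧-trueˡ {true} _ = refl

∧-trueʳ : ∀ {a b} → a ∧ b ≡ true → b ≡ true
∧-trueʳ {true} e = e

not-true : ∀ {a} → not a ≡ true → a ≡ false
not-true {false} _ = refl

true≢false : ∀ {a} → a ≡ true → a ≡ false → ⊥
true≢false refl ()

bool-ext : ∀ {a b} → (a ≡ true → b ≡ true) → (b ≡ true → a ≡ true) → a ≡ b
bool-ext {true} h k = sym (h refl)
bool-ext {false} {false} h k = refl
bool-ext {false} {true} h k = k refl

flat-∧ : ∀ {n} {F H : Fun n} → Flat F → Flat H → Flat (F ∧ᶠ H)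
flat-∧ φ χ = flat λ a b c → ∧-true (closed φ (∧-trueˡ a) (∧-trueˡ b) (∧-trueˡ c))
  (closed χ (∧-trueʳ a) (∧-trueʳ b) (∧-trueʳ c))

flat-affine : ∀ {n} {h : Fun n} → Affine h → Flat h
flat-affine ah = flat λ {x} {y} {z} a b c →
  trans (at-sum ah x y z) (cong₂ _xor_ a (cong₂ _xor_ b c))

flat-shift : ∀ {n} {F : Fun n} u → Flat F → Flat (shift u F)
flat-shift {F = F} u φ = flat λ {x} {y} {z} a b c →
  subst (λ t → F t ≡ true) (⊞-solve (x ∷ y ∷ z ∷ u ∷ []) (x₀ ⊕ x₃ ⊕ (x₁ ⊕ x₃) ⊕ (x₂ ⊕ x₃))
      (x₀ ⊕ x₁ ⊕ x₂ ⊕ x₃) refl) (closed φ a b c)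

flat-invariant : ∀ {n} {F : Fun n} → Flat F → ∀ {p q} → F p ≡ true → F q ≡ true → ∀ x → F (x ⊞ (p ⊞ q)) ≡ F x
flat-invariant {F = F} φ {p} {q} Fp Fq x = bool-ext
  (λ e → subst (λ t → F t ≡ true) (⊞-solve (x ∷ p ∷ q ∷ []) (x₀ ⊕ (x₁ ⊕ x₂) ⊕ x₁ ⊕ x₂) x₀ refl) (closed φ e Fp Fq))
  (λ e → subst (λ t → F t ≡ true) (⊞-assoc x p q) (closed φ e Fp Fq))

-- Sizes of flats

IsPower : ℕ → Set
IsPower m = ∃[ e ] m ≡ 2 ^ e

-- Turns strict inequalities between sizes of flats into a factor of two; the case distinctions on
-- intersections rest on it.
power-< : ∀ {a b} → IsPower a → IsPower b → a < b → 2 * a ≤ b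
power-< (e , refl) (e′ , refl) a<b = ^-monoʳ-≤ 2 {suc e} {e′} (≰⇒> λ e′≤e → <⇒≱ a<b (^-monoʳ-≤ 2 e′≤e))

flat-tail : ∀ {n} {F : Fun (suc n)} a → Flat F → Flat (F ∘ (a ∷_))
flat-tail true φ = flat (closed φ)
flat-tail false φ = flat (closed φ)

-- If both faces of the cube contain points of the flat, a difference of two such points translates
-- one face part onto the other, so the size doubles.
flat-wt : ∀ {n} {F : Fun n} {p} → Flat F → F p ≡ true → IsPower (wt F)
flat-wt {zero} {F} {[]} φ e = 0 , cong 𝟙 e
flat-wt {suc n} {F} {p} φ e with search (F ∘ (false ∷_)) | search (F ∘ (true ∷_))
... | inj₂ e₀ | inj₂ e₁ = ⊥-elim (absurd p e)
  where
  absurd : ∀ p → F p ≡ true → ⊥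
  absurd (false ∷ p) e = true≢false e (e₀ p)
  absurd (true ∷ p) e = true≢false e (e₁ p)
... | inj₁ (x , a) | inj₂ e₁ with k , w ← flat-wt (flat-tail false φ) a =
  k , trans (cong (wt (F ∘ (false ∷_)) +_) (wt-empty e₁)) (trans (+-identityʳ _) w)
... | inj₂ e₀ | inj₁ (y , b) with k , w ← flat-wt (flat-tail true φ) b =
  k , trans (cong (_+ wt (F ∘ (true ∷_))) (wt-empty e₀)) w
... | inj₁ (x , a) | inj₁ (y , b) with k , w ← flat-wt (flat-tail false φ) a =
  suc k , cong₂ _+_ w (trans same (trans w (sym (+-identityʳ _))))
  where
  same : wt (F ∘ (true ∷_)) ≡ wt (F ∘ (false ∷_))
  same = trans (wt-cong λ z → sym (flat-invariant φ a b (true ∷ z))) (wt-shift (x ⊞ y) (F ∘ (false ∷_)))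

-- Translation by `p ⊞ q` preserves `F` and exchanges the two values of `h`.
flat-half : ∀ {n} {F h : Fun n} {p q} → Flat F → Affine h → F p ≡ true → h p ≡ true → F q ≡ true → h q ≡ false →
  2 * wt (F ∧ᶠ h) ≡ wt F
flat-half {F = F} {h} {p} {q} φ ah Fp hp Fq hq = trans (cong (wt (F ∧ᶠ h) +_) (trans (+-identityʳ _) same))
    (wt-split F h)
  where
  same : wt (F ∧ᶠ h) ≡ wt (F ∧ᶠ ¬ᶠ h)
  same = trans (sym (wt-shift (p ⊞ q) (F ∧ᶠ h))) (wt-cong λ x → cong₂ _∧_ (flat-invariant φ Fp Fq x)
    (trans (cong h (sym (⊞-assoc x p q))) (trans (at-sum ah x p q)
        (trans (cong₂ (λ a b → h x xor a xor b) hp hq) (xor-comm (h x) true)))))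

-- An affine function is constant on a flat or halves it, so after fewer than `s` restrictions the
-- flat is empty or still of even size.
I-flat : ∀ {n} s {F : Fun n} → Flat F → 2 ^ s ≤ wt F → I s F
I-flat zero φ _ = tt
I-flat {n} (suc s) {F} φ big = even , part
  where
  point : ∃[ p ] F p ≡ true
  point = wt-pos (≤-trans (m^n>0 2 (suc s)) big)
  even : par F ≡ false
  even with flat-wt φ (proj₂ point)
  ... | zero , w = ⊥-elim (<-irrefl refl (≤-trans (≤-trans (*-monoʳ-≤ 2 (m^n>0 2 s)) big) (≤-reflexive w)))
  ... | suc e , w = trans (cong odd w) (odd-2* (2 ^ e))
  part : ∀ h → Affine h → I s (F ∧ᶠ h)
  part h ah with search (F ∧ᶠ h) | search (F ∧ᶠ ¬ᶠ h)
  ... | inj₂ e | _ = I-0 s e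
  ... | inj₁ _ | inj₂ e = I-flat s (flat-∧ φ (flat-affine ah))
    (≤-trans (≤-trans (m≤m+n (2 ^ s) _) big)
      (≤-reflexive (trans (sym (wt-split F h)) (trans (cong (wt (F ∧ᶠ h) +_) (wt-empty e)) (+-identityʳ _)))))
  ... | inj₁ (p , a) | inj₁ (q , b) = I-flat s (flat-∧ φ (flat-affine ah))
    (*-cancelˡ-≤ 2 (≤-trans big (≤-reflexive (sym (flat-half φ ah (∧-trueˡ a) (∧-trueʳ a) (∧-trueˡ b)
        (not-true (∧-trueʳ b)))))))

-- Separating a point from a flat

affine-scale : ∀ {n} b {h : Fun n} → Affine h → Affine (λ x → b ∧ h x)
affine-scale true ah = affine (at-sum ah)
affine-scale false ah = affine (λ _ _ _ → refl)

affine-head : ∀ {n} → Affine {suc n} head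
affine-head = affine λ { (a ∷ _) (b ∷ _) (c ∷ _) → xor-assoc a b c }

affine-tail : ∀ {n} {h : Fun n} → Affine h → Affine (h ∘ tail)
affine-tail ah = affine λ { (_ ∷ x) (_ ∷ y) (_ ∷ z) → at-sum ah x y z }

not-xor : ∀ a → not a xor a ≡ true
not-xor true = refl
not-xor false = refl

-- By induction there is an `h` that separates `q` from the face part of `J` on the side of `a`. If
-- the opposite part is empty, `h` is used as it is; if the near part is empty, the first coordinate
-- separates. Otherwise the two parts are translates by `w ⊞ y`, and `h` is corrected by the first
-- coordinate with coefficient `κ`, its change along this translation.
separate : ∀ {n} {J : Fun n} {q} → Flat J → J q ≡ false →
  ∃[ h ] (Affine h × (∀ x → J x ≡ true → h x ≡ true) × h q ≡ false)
separate {zero} {J} {[]} φ Jq = (λ _ → false) , affine-const false , (λ { [] e → ⊥-elim (true≢false e Jq) }) , refl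
separate {suc n} {J} {a ∷ q} φ Jq with search (J ∘ (not a ∷_)) | separate (flat-tail a φ) Jq
... | inj₂ none | h , ah , h-true , hq = h ∘ tail , affine-tail ah , on-J , hq
  where
  on-J : ∀ x → J x ≡ true → h (tail x) ≡ true
  on-J (b ∷ x) e with b ≟ᵇ a
  ... | yes refl = h-true x e
  ... | no b≢a rewrite ¬-not b≢a = ⊥-elim (true≢false e (none x))
... | inj₁ (y , Jy) | h , ah , h-true , hq with search (J ∘ (a ∷_))
... | inj₂ none = (λ x → head x xor a) , affine-+ affine-head (affine-const a) , on-J , xor-same a
  where
  on-J : ∀ x → J x ≡ true → head x xor a ≡ true
  on-J (b ∷ x) e with b ≟ᵇ a
  ... | yes refl = ⊥-elim (true≢false e (none x))
  ... | no b≢a rewrite ¬-not b≢a = not-xor a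
... | inj₁ (w , Jw) = (λ x → h (tail x) xor (κ ∧ (head x xor a))) ,
      affine-+ (affine-tail ah) (affine-scale κ (affine-+ affine-head (affine-const a))) , on-J ,
      trans (cong₂ (λ s t → s xor (κ ∧ t)) hq (xor-same a)) (∧-zeroʳ κ)
  where
  κ = h (w ⊞ y) xor h 𝟎
  on-J : ∀ x → J x ≡ true → h (tail x) xor (κ ∧ (head x xor a)) ≡ true
  on-J (b ∷ x) e with b ≟ᵇ a
  ... | yes refl = trans (cong (λ t → h x xor (κ ∧ t)) (xor-same b))
      (trans (cong (h x xor_) (∧-zeroʳ κ)) (trans (xor-identityʳ _) (h-true x e)))
  ... | no b≢a rewrite ¬-not b≢a | not-xor a | ∧-identityʳ κ =
    trans (sym (affine-⊞ ah x (w ⊞ y)))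
      (h-true _ (subst (λ t → J t ≡ true) (cong₂ _∷_ (not-not a)
          (⊞-solve (w ∷ y ∷ x ∷ []) (x₂ ⊕ x₀ ⊕ x₁) (x₂ ⊕ (x₀ ⊕ x₁)) refl)) (closed φ e Jw Jy)))
    where
    not-not : ∀ a → (not a xor a) xor not a ≡ a
    not-not true = refl
    not-not false = refl

infix 4 _≡ᵛ_
_≡ᵛ_ : ∀ {n} → Vec Bool n → Vec Bool n → Bool
x ≡ᵛ y = does (≡-dec _≟ᵇ_ x y)

≡ᵛ-refl : ∀ {n} (x : Vec Bool n) → (x ≡ᵛ x) ≡ true
≡ᵛ-refl x = dec-true (≡-dec _≟ᵇ_ x x) refl

≡ᵛ-sound : ∀ {n} (x y : Vec Bool n) → (x ≡ᵛ y) ≡ true → x ≡ y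
≡ᵛ-sound x y e with ≡-dec _≟ᵇ_ x y
... | yes p = p

wt-≡ᵛ : ∀ {n} (p : Vec Bool n) → wt (_≡ᵛ p) ≡ 1
wt-≡ᵛ [] = refl
wt-≡ᵛ {suc n} (false ∷ p) = cong₂ _+_ (wt-≡ᵛ p) (wt-empty {n} (λ _ → refl))
wt-≡ᵛ {suc n} (true ∷ p) = cong₂ _+_ (wt-empty {n} (λ _ → refl)) (wt-≡ᵛ p)

par-≡ᵛ : ∀ {n} (p : Vec Bool n) (g : Fun n) → par ((_≡ᵛ p) ∧ᶠ g) ≡ g p
par-≡ᵛ p g with g p in gp
... | true = trans (par-cong λ x → bool-ext ∧-trueˡ (λ e → ∧-true e (trans (cong g (≡ᵛ-sound x p e)) gp)))
    (cong odd (wt-≡ᵛ p))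
... | false = cong odd (wt-empty λ x → ¬-not λ e → true≢false
    (trans (cong g (sym (≡ᵛ-sound x p (∧-trueˡ e)))) (∧-trueʳ e)) gp)

flat-point : ∀ {n} (p : Vec Bool n) → Flat (_≡ᵛ p)
flat-point p = flat λ {x} {y} {z} a b c → subst₂ (λ t u → (t ≡ᵛ u) ≡ true)
    (sym (cong₂ _⊞_ (cong₂ _⊞_ (≡ᵛ-sound x p a) (≡ᵛ-sound y p b)) (≡ᵛ-sound z p c)))
  (⊞-cancelʳ p p) (≡ᵛ-refl (p ⊞ p ⊞ p))

separate-points : ∀ {n} {p q : Vec Bool n} → p ≢ q → ∃[ h ] (Affine h × h p ≡ true × h q ≡ false)
separate-points {p = p} {q} p≢q
  with h , ah , h-true , hq ← separate {q = q} (flat-point p) (dec-false (≡-dec _≟ᵇ_ q p) (p≢q ∘ sym)) =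
  h , ah , h-true p (≡ᵛ-refl p) , hq

-- Fibres of affine maps

AffineVec : ∀ {n s} → Vec (Fun n) s → Set
AffineVec = All Affine

level : ∀ {n} → Fun n → Bool → Fun n
level h a x = not (h x xor a)

affine-level : ∀ {n} {h : Fun n} a → Affine h → Affine (level h a)
affine-level a ah = affine-not (affine-+ ah (affine-const a))

fibre : ∀ {n s} → Vec (Fun n) s → Vec Bool s → Fun n
fibre [] [] x = true
fibre (h ∷ hs) (a ∷ A) x = level h a x ∧ fibre hs A x

wt-level : ∀ {n} (f h : Fun n) → wt (f ∧ᶠ level h false) + wt (f ∧ᶠ level h true) ≡ wt f
wt-level f h = trans (cong₂ _+_ (wt-cong λ x → cong (λ t → f x ∧ not t) (xor-identityʳ (h x)))
    (wt-cong λ x → cong (f x ∧_) (pt (h x))))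
  (trans (+-comm (wt (f ∧ᶠ ¬ᶠ h)) _) (wt-split f h))
  where
  pt : ∀ a → not (a xor true) ≡ a
  pt true = refl
  pt false = refl

par-level : ∀ {n} (f h : Fun n) → par (f ∧ᶠ level h false) xor par (f ∧ᶠ level h true) ≡ par f
par-level f h = trans (sym (odd-+ (wt (f ∧ᶠ level h false)) _)) (cong odd (wt-level f h))

∑-fibre : ∀ {n s} (f : Fun n) (hs : Vec (Fun n) s) → ∑ (λ A → wt (f ∧ᶠ fibre hs A)) ≡ wt f
∑-fibre f [] = wt-cong (λ x → ∧-identityʳ (f x))
∑-fibre f (h ∷ hs) = trans (cong₂ _+_ (half false) (half true)) (wt-level f h)
  where
  half : ∀ a → ∑ (λ A → wt (f ∧ᶠ fibre (h ∷ hs) (a ∷ A))) ≡ wt (f ∧ᶠ level h a)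
  half a = trans (∑-cong λ A → wt-cong λ x → sym (∧-assoc (f x) (level h a x) (fibre hs A x)))
      (∑-fibre (f ∧ᶠ level h a) hs)

par-∧-assoc : ∀ {n} (f g h : Fun n) → par (f ∧ᶠ (g ∧ᶠ h)) ≡ par (f ∧ᶠ g ∧ᶠ h)
par-∧-assoc f g h = par-cong (λ x → sym (∧-assoc (f x) (g x) (h x)))

fibre-even : ∀ {n s} {f : Fun n} {hs : Vec (Fun n) s} → AffineVec hs → I (suc s) f → ∀ A → par
    (f ∧ᶠ fibre hs A) ≡ false
fibre-even {f = f} [] (p , _) [] = trans (par-cong (λ x → ∧-identityʳ (f x))) p
fibre-even {f = f} {h ∷ hs} (ah ∷ ahs) (p , k) (a ∷ A) =
  trans (par-∧-assoc f (level h a) (fibre hs A)) (fibre-even ahs (k _ (affine-level a ah)) A)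

xor-false : ∀ {a b} → a xor b ≡ false → a ≡ b
xor-false {true} {true} _ = refl
xor-false {false} {false} _ = refl

-- Two fibres that differ in one coordinate unite to a fibre of the remaining functions, one fewer,
-- where `fibre-even` applies; so their parities agree.
fibre-const : ∀ {n s} {f : Fun n} {hs : Vec (Fun n) s} → AffineVec hs → I s f →
  ∀ A B → par (f ∧ᶠ fibre hs A) ≡ par (f ∧ᶠ fibre hs B)
fibre-const [] i [] [] = refl
fibre-const {s = suc s} {f} {h ∷ hs} (ah ∷ ahs) i@(_ , k) (a ∷ A) (b ∷ B) = begin
  par (f ∧ᶠ fibre (h ∷ hs) (a ∷ A))  ≡⟨ par-∧-assoc f (level h a) (fibre hs A) ⟩
  φ a A                              ≡⟨ fibre-const ahs (k _ (affine-level a ah)) A B ⟩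
  φ a B                              ≡⟨ flip a b ⟩
  φ b B                              ≡⟨ par-∧-assoc f (level h b) (fibre hs B) ⟨
  par (f ∧ᶠ fibre (h ∷ hs) (b ∷ B))  ∎
  where
  open ≡-Reasoning
  φ : Bool → Vec Bool s → Bool
  φ a A = par (f ∧ᶠ level h a ∧ᶠ fibre hs A)
  swap : ∀ a → φ a B ≡ par (f ∧ᶠ fibre hs B ∧ᶠ level h a)
  swap a = par-cong λ x → trans (∧-assoc (f x) _ _)
      (trans (cong (f x ∧_) (∧-comm (level h a x) _)) (sym (∧-assoc (f x) _ _)))
  0≡1 : φ false B ≡ φ true B
  0≡1 = xor-false (trans (cong₂ _xor_ (swap false) (swap true))
    (trans (par-level (f ∧ᶠ fibre hs B) h) (fibre-even ahs i B)))
  flip : ∀ a b → φ a B ≡ φ b B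
  flip true true = refl
  flip false false = refl
  flip false true = 0≡1
  flip true false = sym 0≡1

-- With one function more, the parity is no longer constant but affine in `A`: the values at
-- `false ∷ A` and `true ∷ A` differ by a fibre parity of the other functions, which is the constant
-- `κ` by `fibre-const`, and fixing the first coordinate leaves the same problem for `s` smaller by
-- one.
fibre-affine : ∀ {n s} {f : Fun n} {hs : Vec (Fun n) (suc s)} → AffineVec hs → I s f →
  Affine (λ A → par (f ∧ᶠ fibre hs A))
fibre-affine {n} {s} {f} {h ∷ hs} (ah ∷ ahs) i = affine λ { (a ∷ A) (b ∷ B) (c ∷ C) → main a b c A B C }
  where
  open ≡-Reasoning
  φ : Bool → Vec Bool s → Bool
  φ a A = par (f ∧ᶠ fibre (h ∷ hs) (a ∷ A))
  ψ : Vec Bool s → Bool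
  ψ A = par (f ∧ᶠ fibre hs A)
  φ-sum : ∀ A → φ false A xor φ true A ≡ ψ A
  φ-sum A = trans (cong₂ _xor_ (swap false) (swap true)) (par-level (f ∧ᶠ fibre hs A) h)
    where
    swap : ∀ a → φ a A ≡ par (f ∧ᶠ fibre hs A ∧ᶠ level h a)
    swap a = par-cong λ x → trans (cong (f x ∧_) (∧-comm (level h a x) _)) (sym (∧-assoc (f x) _ _))
  κ = ψ 𝟎
  cancel : ∀ a b → b ≡ a xor (a xor b)
  cancel true b = sym (not-involutive b)
  cancel false b = refl
  φ-lin : ∀ a A → φ a A ≡ φ false A xor (a ∧ κ)
  φ-lin false A = sym (xor-identityʳ _)
  φ-lin true A = begin
    φ true A                                   ≡⟨ cancel (φ false A) (φ true A) ⟩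
    φ false A xor (φ false A xor φ true A)     ≡⟨ cong (φ false A xor_) (trans (φ-sum A) (fibre-const ahs i A 𝟎)) ⟩
    φ false A xor κ                            ∎
  φ₀-affine : ∀ {s} {f : Fun n} {hs : Vec (Fun n) s} → AffineVec hs → I s f →
    Affine (λ A → par (f ∧ᶠ fibre (h ∷ hs) (false ∷ A)))
  φ₀-affine {zero} {f} [] _ = affine λ { [] [] [] → cancel (par (f ∧ᶠ fibre (h ∷ []) (false ∷ []))) _ }
  φ₀-affine {suc s} {f} {hs} ahs (_ , k) = affine λ A B C →
    trans (assoc _) (trans (at-sum (fibre-affine ahs (k _ (affine-level false ah))) A B C)
      (sym (cong₂ _xor_ (assoc A) (cong₂ _xor_ (assoc B) (assoc C)))))
    where
    assoc : ∀ A → par (f ∧ᶠ fibre (h ∷ hs) (false ∷ A)) ≡ par (f ∧ᶠ level h false ∧ᶠ fibre hs A)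
    assoc A = par-∧-assoc f (level h false) (fibre hs A)
  main : ∀ a b c A B C → φ ((a xor b) xor c) (A ⊞ B ⊞ C) ≡ φ a A xor φ b B xor φ c C
  main a b c A B C = begin
    φ ((a xor b) xor c) (A ⊞ B ⊞ C)
      ≡⟨ φ-lin ((a xor b) xor c) (A ⊞ B ⊞ C) ⟩
    φ false (A ⊞ B ⊞ C) xor (((a xor b) xor c) ∧ κ)
      ≡⟨ cong₂ _xor_ (at-sum (φ₀-affine ahs i) A B C)
          (trans (cong (_∧ κ) (xor-assoc a b c)) (trans (∧-distribʳ-xor κ a _)
              (cong ((a ∧ κ) xor_) (∧-distribʳ-xor κ b c)))) ⟩
    (φ false A xor (φ false B xor φ false C)) xor ((a ∧ κ) xor ((b ∧ κ) xor (c ∧ κ)))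
      ≡⟨ trans (xor-interchange (φ false A) _ (a ∧ κ) _)
          (cong ((φ false A xor (a ∧ κ)) xor_) (xor-interchange (φ false B) _ (b ∧ κ) _)) ⟩
    (φ false A xor (a ∧ κ)) xor ((φ false B xor (b ∧ κ)) xor (φ false C xor (c ∧ κ)))
      ≡⟨ cong₂ _xor_ (φ-lin a A) (cong₂ _xor_ (φ-lin b B) (φ-lin c C)) ⟨
    φ a A xor φ b B xor φ c C ∎

-- Minimum distance and odd fibres

wt-halves : ∀ {n} (f h : Fun n) {q} → q ≤ wt (f ∧ᶠ h) → q ≤ wt (f ∧ᶠ ¬ᶠ h) → 2 * q ≤ wt f
wt-halves f h {q} a b = ≤-trans (≤-reflexive (cong (q +_) (+-identityʳ q)))
    (≤-trans (+-mono-≤ a b) (≤-reflexive (wt-split f h)))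

distinct-pair : ∀ {n} {f : Fun n} {p} → f p ≡ true → par f ≡ false → ∃[ q ] (q ≢ p × f q ≡ true)
distinct-pair {f = f} {p} fp even with search (f ∧ᶠ ¬ᶠ (_≡ᵛ p))
... | inj₁ (q , e) = q , (λ { refl → true≢false (≡ᵛ-refl p) (not-true (∧-trueʳ e)) }) , ∧-trueˡ e
... | inj₂ none = ⊥-elim (true≢false (trans (par-cong alone) (cong odd (wt-≡ᵛ p))) even)
  where
  alone : f ≗ (_≡ᵛ p)
  alone x = bool-ext
    (λ fx → ¬-not λ n → true≢false (cong₂ _∧_ fx (cong not n)) (none x))
    (λ e → trans (cong f (≡ᵛ-sound x p e)) fp)

-- An affine function that separates two points of `f` leaves nonempty words of index one lower on
-- both sides.
min-weight : ∀ {n} s {f : Fun n} {p} → I s f → f p ≡ true → 2 ^ s ≤ wt f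
min-weight zero {f} {p} i fp = wt-point {f = f} {p} fp
min-weight (suc s) {f} {p} (even , k) fp with q , q≢p , fq ← distinct-pair {f = f} fp even
  with h , ah , hq , hp ← separate-points q≢p =
  wt-halves f h (min-weight s (k h ah) (∧-true fq hq))
    (min-weight s (k (¬ᶠ h) (affine-not ah)) (∧-true fp (cong not hp)))

-- The recursion of `min-weight` with the bound doubled: at the bottom a nonempty word is odd or has
-- two points. An odd fibre found on either side is enough; otherwise both sides are heavy.
odd-fibre : ∀ {n} s {f : Fun n} {p} → I s f → f p ≡ true →
  (2 ^ suc s ≤ wt f) ⊎ (Σ[ hs ∈ Vec (Fun n) s ] Σ[ A ∈ Vec Bool s ] (AffineVec hs × par (f ∧ᶠ fibre hs A) ≡ true))
odd-fibre zero {f} {p} i fp with par f in e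
... | true = inj₂ ([] , [] , [] , trans (par-cong (λ x → ∧-identityʳ (f x))) e)
... | false with q , q≢p , fq ← distinct-pair {f = f} fp e with h , ah , hq , hp ← separate-points q≢p =
  inj₁ (wt-halves f h (wt-point {x = q} (∧-true fq hq)) (wt-point {x = p} (∧-true fp (cong not hp))))
odd-fibre (suc s) {f} {p} (even , k) fp
  with q , q≢p , fq ← distinct-pair {f = f} fp even
  with h , ah , hq , hp ← separate-points q≢p
  with odd-fibre s (k (level h true) (affine-level true ah)) (∧-true fq (cong (λ b → not (b xor true)) hq))
     | odd-fibre s (k (level h false) (affine-level false ah)) (∧-true fp (cong (λ b → not (b xor false)) hp))
... | inj₂ (hs , A , ahs , e) | _ = inj₂ (h ∷ hs , true ∷ A , ah ∷ ahs , trans (par-∧-assoc f _ _) e)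
... | inj₁ _ | inj₂ (hs , A , ahs , e) = inj₂ (h ∷ hs , false ∷ A , ah ∷ ahs , trans (par-∧-assoc f _ _) e)
... | inj₁ a | inj₁ b = inj₁ (≤-trans (≤-reflexive (cong (2 ^ suc s +_) (+-identityʳ _)))
  (≤-trans (+-mono-≤ b a) (≤-reflexive (wt-level f h))))

vec-ext : ∀ {n} {x y : Vec Bool n} → (∀ j → lookup x j ≡ lookup y j) → x ≡ y
vec-ext {x = x} {y} e = trans (sym (tabulate∘lookup x)) (trans (tabulate-cong e) (tabulate∘lookup y))

lookup-⊞₃ : ∀ {n} j (x y z : Vec Bool n) → lookup (x ⊞ y ⊞ z) j ≡ lookup x j xor lookup y j xor lookup z j
lookup-⊞₃ j x y z = trans (lookup-zipWith _xor_ j (x ⊞ y) z)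
  (trans (cong (_xor lookup z j) (lookup-zipWith _xor_ j x y)) (xor-assoc (lookup x j) _ _))

affine-lookup : ∀ {n} j → Affine {n} (λ x → lookup x j)
affine-lookup j = affine (lookup-⊞₃ j)

fibre-sound : ∀ {n s} (hs : Vec (Fun n) s) A x → fibre hs A x ≡ true → map (λ h → h x) hs ≡ A
fibre-sound [] [] x e = refl
fibre-sound (h ∷ hs) (a ∷ A) x e = cong₂ _∷_ (xor-false (not-true (∧-trueˡ e)))
    (fibre-sound hs A x (∧-trueʳ {level h a x} e))

map-⊞₃ : ∀ {n s} {hs : Vec (Fun n) s} → AffineVec hs → ∀ x y z →
  map (λ h → h (x ⊞ y ⊞ z)) hs ≡ map (λ h → h x) hs ⊞ map (λ h → h y) hs ⊞ map (λ h → h z) hs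
map-⊞₃ [] x y z = refl
map-⊞₃ {hs = h ∷ hs} (ah ∷ ahs) x y z = cong₂ _∷_ (trans (at-sum ah x y z) (sym (xor-assoc (h x) _ _)))
    (map-⊞₃ ahs x y z)

-- Every fibre of hs meets f in an odd set; the sums of these sets form a flat L.
-- As wt f < 2 ^ (s + 1), most of these sets are singletons, so most points of L lie in f.
module Majority {n s} {f : Fun n} (i : I s f) {hs : Vec (Fun n) s} (ahs : AffineVec hs)
  (odd-fibres : ∀ A → par (f ∧ᶠ fibre hs A) ≡ true) (light : wt f < 2 ^ suc s) where

  pos : Vec Bool n → Vec Bool s
  pos x = map (λ h → h x) hs

  -- Coordinate `j` of the sum, over 𝔽₂, of the points of `f` in the fibre over `A`.
  coordinate : Fin n → Vec Bool s → Bool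
  coordinate j A = par (f ∧ᶠ (λ x → lookup x j) ∧ᶠ fibre hs A)

  pt : Vec Bool s → Vec Bool n
  pt A = tabulate (λ j → coordinate j A)

  -- Written as the fixed points of `pt ∘ pos`, the set is a flat because both maps are affine, and
  -- it has at most one point in each fibre. Its exact size comes only from counting, in `wt-L`.
  L : Fun n
  L x = x ≡ᵛ pt (pos x)

  coordinate-affine : ∀ j → Affine (coordinate j)
  coordinate-affine j = cases s i ahs
    where
    cases : ∀ s → I s f → {hs : Vec (Fun n) s} → AffineVec hs → Affine
        (λ A → par (f ∧ᶠ (λ x → lookup x j) ∧ᶠ fibre hs A))
    cases zero _ [] = affine λ { [] [] [] → cancel _ }
      where
      cancel : ∀ a → a ≡ a xor a xor a
      cancel true = refl
      cancel false = refl
    cases (suc s) (_ , k) ahs = fibre-affine ahs (k _ (affine-lookup j))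

  pt-⊞₃ : ∀ A B C → pt (A ⊞ B ⊞ C) ≡ pt A ⊞ pt B ⊞ pt C
  pt-⊞₃ A B C = vec-ext λ j → begin
    lookup (pt (A ⊞ B ⊞ C)) j                                   ≡⟨ lookup∘tabulate _ j ⟩
    coordinate j (A ⊞ B ⊞ C)                                    ≡⟨ at-sum (coordinate-affine j) A B C ⟩
    coordinate j A xor coordinate j B xor coordinate j C
        ≡⟨ cong₂ _xor_ (lookup∘tabulate _ j) (cong₂ _xor_ (lookup∘tabulate _ j) (lookup∘tabulate _ j)) ⟨
    lookup (pt A) j xor lookup (pt B) j xor lookup (pt C) j     ≡⟨ lookup-⊞₃ j (pt A) (pt B) (pt C) ⟨
    lookup (pt A ⊞ pt B ⊞ pt C) j                               ∎
    where open ≡-Reasoning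

  L-sound : ∀ x → L x ≡ true → x ≡ pt (pos x)
  L-sound x = ≡ᵛ-sound x (pt (pos x))

  L-complete : ∀ {x} → x ≡ pt (pos x) → L x ≡ true
  L-complete {x} e = trans (cong (x ≡ᵛ_) (sym e)) (≡ᵛ-refl x)

  L-flat : Flat L
  L-flat = flat λ {x} {y} {z} a b c → L-complete
    (trans (cong₂ _⊞_ (cong₂ _⊞_ (L-sound x a) (L-sound y b)) (L-sound z c))
      (trans (sym (pt-⊞₃ (pos x) (pos y) (pos z))) (cong pt (sym (map-⊞₃ ahs x y z)))))

  pos-fibre : ∀ {A x} → fibre hs A x ≡ true → pos x ≡ A
  pos-fibre {A} {x} = fibre-sound hs A x

  L-fibre : ∀ A → wt (L ∧ᶠ fibre hs A) ≤ 1
  L-fibre A = ≤-trans (wt-mono {g = _≡ᵛ pt A} λ x e → subst (λ B → (x ≡ᵛ pt B) ≡ true)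
      (pos-fibre (∧-trueʳ {L x} e)) (∧-trueˡ e))
    (≤-reflexive (wt-≡ᵛ (pt A)))

  singleton : ∀ A → wt (f ∧ᶠ fibre hs A) ≡ 1 → 1 ≤ wt (f ∧ᶠ L ∧ᶠ fibre hs A)
  singleton A one with x , e ← wt-pos {f = f ∧ᶠ fibre hs A} (≤-reflexive (sym one)) =
    wt-point {x = x} (∧-true (∧-true (∧-trueˡ e) (L-complete
        (trans x≡pt (cong pt (sym (pos-fibre (∧-trueʳ {f x} e))))))) (∧-trueʳ {f x} e))
    where
    alone : (f ∧ᶠ fibre hs A) ≗ (_≡ᵛ x)
    alone y = bool-ext
      (wt-⊆-≥ {f = _≡ᵛ x} (λ z e′ → subst (λ t → (f ∧ᶠ fibre hs A) t ≡ true) (sym (≡ᵛ-sound z x e′)) e)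
          (≤-reflexive (trans one (sym (wt-≡ᵛ x)))) y)
      (λ e′ → subst (λ t → (f ∧ᶠ fibre hs A) t ≡ true) (sym (≡ᵛ-sound y x e′)) e)
    x≡pt : x ≡ pt A
    x≡pt = vec-ext λ j → sym (trans (lookup∘tabulate _ j) (trans (par-cong λ y → reorder (f y) (lookup y j) _)
      (trans (par-cong λ y → cong (_∧ lookup y j) (alone y)) (par-≡ᵛ x (λ y → lookup y j)))))
      where
      reorder : ∀ a b c → (a ∧ b) ∧ c ≡ (a ∧ c) ∧ b
      reorder true true c = sym (∧-identityʳ c)
      reorder true false c = sym (∧-zeroʳ c)
      reorder false b c = refl

  -- A fibre with one point of `f` has that point in `L` and contributes `1 + 2`; any other odd
  -- fibre contributes at least three by itself. Summed over all fibres and compared with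
  -- `wt f < 2 * 2 ^ s`, this gives `majority`.
  fibre-bound : ∀ A → 3 ≤ wt (f ∧ᶠ fibre hs A) + 2 * wt (f ∧ᶠ L ∧ᶠ fibre hs A)
  fibre-bound A with wt (f ∧ᶠ fibre hs A) in w | odd-fibres A
  ... | 1 | _ = +-monoʳ-≤ 1 (*-monoʳ-≤ 2 (singleton A w))
  ... | suc (suc (suc m)) | _ = s≤s (s≤s (s≤s z≤n))

  majority : 2 ^ s < 2 * wt (f ∧ᶠ L)
  majority = lin≤ 0 (+-mono-≤ total light) (ar (2 ^ s) (wt f) (wt (f ∧ᶠ L)))
    where
    ar : ∀ q w c → suc q + ((w + 2 * c) + 2 * q) + 0 ≡ 2 * c + (3 * q + suc w)
    ar = solve-∀
    total : 3 * 2 ^ s ≤ wt f + 2 * wt (f ∧ᶠ L)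
    total = begin
      3 * 2 ^ s                                                                ≡⟨ ∑-const s 3 ⟨
      ∑ {s} (λ _ → 3)                                                          ≤⟨ ∑-mono fibre-bound ⟩
      ∑ (λ A → wt (f ∧ᶠ fibre hs A) + 2 * wt (f ∧ᶠ L ∧ᶠ fibre hs A))           ≡⟨ ∑-+ (λ A → wt (f ∧ᶠ fibre hs A)) _ ⟩
      ∑ (λ A → wt (f ∧ᶠ fibre hs A)) + ∑ (λ A → 2 * wt (f ∧ᶠ L ∧ᶠ fibre hs A))
          ≡⟨ cong₂ _+_ (∑-fibre f hs) (trans (∑-* 2 (λ A → wt (f ∧ᶠ L ∧ᶠ fibre hs A)))
              (cong (2 *_) (∑-fibre (f ∧ᶠ L) hs))) ⟩
      wt f + 2 * wt (f ∧ᶠ L)                                                   ∎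
      where open ≤-Reasoning

  -- One point per fibre bounds the size above by `2 ^ s`; a smaller power of two is at most half of
  -- that, which contradicts `majority`.
  wt-L : wt L ≡ 2 ^ s
  wt-L with x , e ← wt-pos {f = f ∧ᶠ L} (*-cancelˡ-< 2 0 _ (≤-trans (m^n>0 2 s) (<⇒≤ majority))) =
    ≤-antisym upper (≮⇒≥ λ lt → <-irrefl refl (<-≤-trans majority
        (≤-trans (*-monoʳ-≤ 2 (wt-mono λ y e → ∧-trueʳ {f y} e))
            (power-< (flat-wt {p = x} L-flat (∧-trueʳ {f x} e)) (s , refl) lt))))
    where
    upper : wt L ≤ 2 ^ s
    upper = begin
      wt L                            ≡⟨ ∑-fibre L hs ⟨
      ∑ (λ A → wt (L ∧ᶠ fibre hs A))  ≤⟨ ∑-mono L-fibre ⟩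
      ∑ {s} (λ _ → 1)                 ≡⟨ ∑-const s 1 ⟩
      1 * 2 ^ s                       ≡⟨ +-identityʳ _ ⟩
      2 ^ s                           ∎
      where open ≤-Reasoning

majority-flat : ∀ {n} s {f : Fun n} {p} → I s f → f p ≡ true → wt f < 2 ^ suc s →
  ∃[ L ] (Flat L × wt L ≡ 2 ^ s × 2 ^ s < 2 * wt (f ∧ᶠ L))
majority-flat s {f} i fp light with odd-fibre s i fp
... | inj₁ heavy = ⊥-elim (<⇒≱ light heavy)
... | inj₂ (hs , A , ahs , e) = L , L-flat , wt-L , majority
  where open Majority i ahs (λ B → trans (fibre-const ahs i B A) e) light

-- Hulls of two flats with a common point

some : ∀ {n} → Fun n → Bool
some f with search f
... | inj₁ _ = true
... | inj₂ _ = false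

some-intro : ∀ {n} (f : Fun n) a → f a ≡ true → some f ≡ true
some-intro f a e with search f
... | inj₁ _ = refl
... | inj₂ none = ⊥-elim (true≢false e (none a))

some-elim : ∀ {n} (f : Fun n) → some f ≡ true → ∃[ a ] f a ≡ true
some-elim f e with search f
... | inj₁ r = r

on : ∀ {n} (F : Fun n) {x y} → x ≡ y → F x ≡ true → F y ≡ true
on F e = subst (λ t → F t ≡ true) e

-- The sums `a ⊞ b ⊞ p` with `a` in `X` and `b` in `Y`: the flat spanned by `X` and `Y` when `p`
-- lies in both.
hull : ∀ {n} → Fun n → Fun n → Vec Bool n → Fun n
hull X Y p x = some (λ a → X a ∧ Y (x ⊞ (a ⊞ p)))

module Hull {n} {X Y : Fun n} (φ : Flat X) (χ : Flat Y) {p} (Xp : X p ≡ true) (Yp : Y p ≡ true) where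

  hull-⊇ˡ : ∀ x → X x ≡ true → hull X Y p x ≡ true
  hull-⊇ˡ x Xx = some-intro _ x (∧-true Xx (on Y (⊞-solve (x ∷ p ∷ []) x₁ (x₀ ⊕ (x₀ ⊕ x₁)) refl) Yp))

  hull-⊇ʳ : ∀ y → Y y ≡ true → hull X Y p y ≡ true
  hull-⊇ʳ y Yy = some-intro _ p (∧-true Xp (on Y (⊞-solve (y ∷ p ∷ []) x₀ (x₀ ⊕ (x₁ ⊕ x₁)) refl) Yy))

  hull-⊆ : ∀ {L} → Flat L → (∀ x → X x ≡ true → L x ≡ true) → (∀ x → Y x ≡ true → L x ≡ true) →
    ∀ x → hull X Y p x ≡ true → L x ≡ true
  hull-⊆ {L} ψ X⊆L Y⊆L x e with a , e′ ← some-elim _ e =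
    on L (⊞-solve (x ∷ a ∷ p ∷ []) (x₀ ⊕ (x₁ ⊕ x₂) ⊕ x₁ ⊕ x₂) x₀ refl)
      (closed ψ (Y⊆L _ (∧-trueʳ {X a} e′)) (X⊆L a (∧-trueˡ e′)) (X⊆L p Xp))

  hull-flat : Flat (hull X Y p)
  hull-flat = flat λ {x} {y} {z} e₁ e₂ e₃ → sums (some-elim _ e₁) (some-elim _ e₂) (some-elim _ e₃)
    where
    sums : ∀ {x y z} → ∃[ a ] X a ∧ Y (x ⊞ (a ⊞ p)) ≡ true → ∃[ b ] X b ∧ Y (y ⊞ (b ⊞ p)) ≡ true →
      ∃[ c ] X c ∧ Y (z ⊞ (c ⊞ p)) ≡ true → hull X Y p (x ⊞ y ⊞ z) ≡ true
    sums {x} {y} {z} (a , e₁) (b , e₂) (c , e₃) = some-intro _ (a ⊞ b ⊞ c) (∧-true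
      (closed φ (∧-trueˡ e₁) (∧-trueˡ e₂) (∧-trueˡ e₃))
      (on Y (⊞-solve (x ∷ y ∷ z ∷ p ∷ a ∷ b ∷ c ∷ [])
          (x₀ ⊕ (x₄ ⊕ x₃) ⊕ (x₁ ⊕ (x₅ ⊕ x₃)) ⊕ (x₂ ⊕ (x₆ ⊕ x₃))) (x₀ ⊕ x₁ ⊕ x₂ ⊕ (x₄ ⊕ x₅ ⊕ x₆ ⊕ x₃)) refl)
        (closed χ (∧-trueʳ {X a} e₁) (∧-trueʳ {X b} e₂) (∧-trueʳ {X c} e₃))))
      where
      x₄ = var (suc (suc (suc (suc zero))))
      x₅ = var (suc (suc (suc (suc (suc zero)))))
      x₆ = var (suc (suc (suc (suc (suc (suc zero))))))

  count : Vec Bool n → ℕ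
  count x = wt (λ a → X a ∧ Y (x ⊞ (a ⊞ p)))

  -- Solutions a of x ∈ a + Y + p form a translate of X ∩ Y.
  count-hull : ∀ x → count x ≡ wt (X ∧ᶠ Y) * 𝟙 (hull X Y p x)
  count-hull x with search (λ a → X a ∧ Y (x ⊞ (a ⊞ p)))
  ... | inj₂ none = trans (wt-empty none) (sym (*-zeroʳ (wt (X ∧ᶠ Y))))
  ... | inj₁ (a , e) = trans (trans (sym (wt-shift (a ⊞ p) (λ b → X b ∧ Y (x ⊞ (b ⊞ p))))) (wt-cong λ b → cong₂ _∧_
      (flat-invariant φ (∧-trueˡ e) Xp b)
      (trans (cong Y (⊞-solve (x ∷ b ∷ a ∷ p ∷ []) (x₀ ⊕ (x₁ ⊕ (x₂ ⊕ x₃) ⊕ x₃)) (x₁ ⊕ (x₀ ⊕ (x₂ ⊕ x₃) ⊕ x₃)) refl))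
        (flat-invariant χ (∧-trueʳ {X a} e) Yp b))))
      (sym (*-identityʳ _))

  -- The dimension formula, by counting the pairs of a point of `X` and a point of `Y` according to
  -- the point of the hull that they give.
  hull-wt : wt (hull X Y p) * wt (X ∧ᶠ Y) ≡ wt X * wt Y
  hull-wt = begin
    wt (hull X Y p) * wt (X ∧ᶠ Y)                        ≡⟨ *-comm (wt (hull X Y p)) _ ⟩
    wt (X ∧ᶠ Y) * wt (hull X Y p)                        ≡⟨ ∑-* (wt (X ∧ᶠ Y)) (𝟙 ∘ hull X Y p) ⟨
    ∑ (λ x → wt (X ∧ᶠ Y) * 𝟙 (hull X Y p x))             ≡⟨ ∑-cong count-hull ⟨
    ∑ (λ x → ∑ (λ a → 𝟙 (X a ∧ Y (x ⊞ (a ⊞ p)))))        ≡⟨ ∑-swap (λ x a → 𝟙 (X a ∧ Y (x ⊞ (a ⊞ p)))) ⟩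
    ∑ (λ a → ∑ (λ x → 𝟙 (X a ∧ Y (x ⊞ (a ⊞ p)))))        ≡⟨ ∑-cong (λ a → slice (X a) (a ⊞ p)) ⟩
    ∑ (λ a → wt Y * 𝟙 (X a))                             ≡⟨ ∑-* (wt Y) (𝟙 ∘ X) ⟩
    wt Y * wt X                                          ≡⟨ *-comm (wt Y) _ ⟩
    wt X * wt Y                                          ∎
    where
    open ≡-Reasoning
    slice : ∀ b u → ∑ (λ x → 𝟙 (b ∧ Y (x ⊞ u))) ≡ wt Y * 𝟙 b
    slice true u = trans (wt-shift u Y) (sym (*-identityʳ _))
    slice false u = trans (∑-0 {n}) (sym (*-zeroʳ (wt Y)))

open Hull

-- Words of minimum weight

light-empty : ∀ {n} s {f : Fun n} → I s f → wt f < 2 ^ s → ∀ x → f x ≡ false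
light-empty s i light x = ¬-not λ e → <⇒≱ light (min-weight s i e)

-- Admits the empty word besides those of minimum weight, since two equal flats cancel.
Small : ∀ {n} → ℕ → Fun n → Set
Small s X = I s X × wt X ≤ 2 ^ s

IsFlat : ∀ {n} → ℕ → Fun n → Set
IsFlat s X = Flat X × wt X ≡ 2 ^ s

flat-small : ∀ {n} s {X : Fun n} → IsFlat s X → Small s X
flat-small s (φ , w) = I-flat s φ (≤-reflexive (sym w)) , ≤-reflexive w

flat-cong : ∀ {n} {X Y : Fun n} → X ≗ Y → Flat X → Flat Y
flat-cong e φ = flat λ a b c → trans (sym (e _)) (closed φ (trans (e _) a) (trans (e _) b) (trans (e _) c))

+ᶠ-empty : ∀ {n} {X Y : Fun n} → (∀ x → (X +ᶠ Y) x ≡ false) → X ≗ Y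
+ᶠ-empty e x = xor-false (e x)

2^s<2^1+s : ∀ s → 2 ^ s < 2 ^ suc s
2^s<2^1+s s = ^-monoʳ-< 2 (s≤s (s≤s z≤n)) (n<1+n s)

-- The majority flat of a word of minimum weight shares more than half of its points, so their sum
-- is below the minimum distance and vanishes.
small-cases : ∀ {n} s {X : Fun n} → Small s X → (∀ x → X x ≡ false) ⊎ IsFlat s X
small-cases s {X} (i , w≤) with search X
... | inj₂ none = inj₁ none
... | inj₁ (p , Xp) with w ← ≤-antisym w≤ (min-weight s i Xp)
  with L , φ , wL , maj ← majority-flat s {X} i Xp (≤-<-trans w≤ (2^s<2^1+s s)) =
  inj₂ (flat-cong (λ x → sym (+ᶠ-empty {X = X} {L} (light-empty s (I-+ s i (proj₁ (flat-small s (φ , wL))))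
      (lt w wL maj)) x)) φ , w)
  where
  lt : ∀ {L} → wt X ≡ 2 ^ s → wt L ≡ 2 ^ s → 2 ^ s < 2 * wt (X ∧ᶠ L) → wt (X +ᶠ L) < 2 ^ s
  lt {L} w wL maj = lin≤ 0 (+-mono-≤ maj (≤-reflexive (trans (wt-+ X L) (cong₂ _+_ w wL))))
    (ar (wt (X +ᶠ L)) (wt (X ∧ᶠ L)) (2 ^ s))
    where
    ar : ∀ W c q → suc W + (2 * c + (q + q)) + 0 ≡ q + (suc q + (W + 2 * c))
    ar = solve-∀

small-sum : ∀ {n} s {X Y : Fun n} → Small s X → Small s Y → 2 ^ s ≤ 2 * wt (X ∧ᶠ Y) → Small s (X +ᶠ Y)
small-sum s {X} {Y} (i , w) (j , v) big = I-+ s i j ,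
  lin≤ 0 (+-mono-≤ big (+-mono-≤ (≤-reflexive (wt-+ X Y)) (+-mono-≤ w v)))
    (ar (wt (X +ᶠ Y)) (wt (X ∧ᶠ Y)) (wt X) (wt Y) (2 ^ s))
  where
  ar : ∀ W c x y q → W + (2 * c + ((x + y) + (q + q))) + 0 ≡ q + (q + ((W + 2 * c) + (x + y)))
  ar = solve-∀

wt-two-copies : ∀ {n} (Z K : Fun n) u → (∀ x → Z x ≡ true → K x ≡ true) → (∀ x → Z (x ⊞ u) ≡ true → K x ≡ true) →
  (∀ x → Z x ≡ true → Z (x ⊞ u) ≡ true → ⊥) → 2 * wt Z ≤ wt K
wt-two-copies Z K u a b disj = begin
  2 * wt Z                            ≡⟨ cong (wt Z +_) (+-identityʳ _) ⟩
  wt Z + wt Z                         ≡⟨ cong (wt Z +_) (wt-shift u Z) ⟨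
  wt Z + wt (shift u Z)               ≡⟨ ∑-+ (𝟙 ∘ Z) _ ⟨
  ∑ (λ x → 𝟙 (Z x) + 𝟙 (Z (x ⊞ u)))   ≤⟨ ∑-mono (λ x → pt (Z x) (Z (x ⊞ u)) (K x) (a x) (b x) (disj x)) ⟩
  wt K                                ∎
  where
  open ≤-Reasoning
  pt : ∀ p q r → (p ≡ true → r ≡ true) → (q ≡ true → r ≡ true) → (p ≡ true → q ≡ true → ⊥) → 𝟙 p + 𝟙 q ≤ 𝟙 r
  pt true true r a b d = ⊥-elim (d refl refl)
  pt true false r a b d rewrite a refl = ≤-refl
  pt false true r a b d rewrite b refl = ≤-refl
  pt false false r a b d = z≤n

quarter-pos : ∀ s {x} → 4 * x ≡ 2 ^ s → 1 ≤ x
quarter-pos s {zero} e = ⊥-elim (<-irrefl e (m^n>0 2 s))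
quarter-pos s {suc x} e = s≤s z≤n

-- If L₁ and L₂ meet L₀ in disjoint quarters, the sum of the three flats is a sum of two:
-- with p ∈ L₁ ∩ L₂ and r ∈ L₂ ∩ L₀, and H₀ a half of L₀ containing L₂ ∩ L₀ and avoiding L₁ ∩ L₀,
-- the flat F₀ = H₀ ∪ (H₀ + p + r) meets L₀ and L₂ in a half, and F₀ + L₀ meets L₁ in a half.
module Regroup {n} s {L₀ L₁ L₂ : Fun n} (fl₀ : IsFlat s L₀) (fl₁ : IsFlat s L₁) (fl₂ : IsFlat s L₂)
  (quarter₁ : 4 * wt (L₀ ∧ᶠ L₁) ≡ 2 ^ s) (quarter₂ : 4 * wt (L₀ ∧ᶠ L₂) ≡ 2 ^ s)
  {p t r} (p₁ : L₁ p ≡ true) (p₂ : L₂ p ≡ true) (t₀ : L₀ t ≡ true) (t₁ : L₁ t ≡ true) (r₀ : L₀ r ≡ true)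
      (r₂ : L₂ r ≡ true)
  (none : ∀ x → L₀ x ≡ true → L₁ x ≡ true → L₂ x ≡ true → ⊥) where

  φ₀ : Flat L₀
  φ₀ = proj₁ fl₀
  φ₁ : Flat L₁
  φ₁ = proj₁ fl₁
  φ₂ : Flat L₂
  φ₂ = proj₁ fl₂

  Z Y : Fun n
  Z = L₀ ∧ᶠ L₁
  Y = L₀ ∧ᶠ L₂

  -- The point `p` of `L₁` and `L₂` is not in `L₀`, so `L₀` is disjoint from its translate by
  -- `p ⊞ a`.
  outside : ∀ {a} → L₀ a ≡ true → ∀ {x} → L₀ x ≡ true → L₀ (x ⊞ (p ⊞ a)) ≡ true → ⊥
  outside {a} a₀ {x} x₀′ e = none p
    (on L₀ (⊞-solve (x ∷ p ∷ a ∷ []) (x₀ ⊕ (x₀ ⊕ (x₁ ⊕ x₂)) ⊕ x₂) x₁ refl) (closed φ₀ x₀′ e a₀)) p₁ p₂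

  -- The translate of `Z` through `r` is included so that `h`, being false at `t`, is false on all
  -- of `Z` (`h-Z`). The hull avoids `t`: writing `t` as a sum of `a` in `Y`, a point of the
  -- translate and `r` would put `a` into all three flats.
  separation : ∃[ h ] (Affine h × (∀ x → Y x ≡ true → h x ≡ true) ×
      (∀ x → Z (x ⊞ (t ⊞ r)) ≡ true → h x ≡ true) × h t ≡ false)
  separation = let h , ah , h-J , ht = separate (hull-flat φY φZ′ Yr Zr) avoids-t in
    h , ah , (λ x e → h-J x (hull-⊇ˡ φY φZ′ Yr Zr x e)) , (λ x e → h-J x (hull-⊇ʳ φY φZ′ Yr Zr x e)) , ht
    where
    φY : Flat Y
    φY = flat-∧ φ₀ φ₂
    φZ′ : Flat (shift (t ⊞ r) Z)
    φZ′ = flat-shift (t ⊞ r) (flat-∧ φ₀ φ₁)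
    Yr : Y r ≡ true
    Yr = ∧-true r₀ r₂
    Zr : Z (r ⊞ (t ⊞ r)) ≡ true
    Zr = on Z (⊞-solve (t ∷ r ∷ []) x₀ (x₁ ⊕ (x₀ ⊕ x₁)) refl) (∧-true t₀ t₁)
    avoids-t : hull Y (shift (t ⊞ r) Z) r t ≡ false
    avoids-t = ¬-not λ e → let a , e′ = some-elim _ e in
      none a (∧-trueˡ (∧-trueˡ e′))
        (∧-trueʳ {L₀ a} (on Z (⊞-solve (t ∷ a ∷ r ∷ []) (x₀ ⊕ (x₁ ⊕ x₂) ⊕ (x₀ ⊕ x₂)) x₁ refl) (∧-trueʳ {Y a} e′)))
        (∧-trueʳ {L₀ a} (∧-trueˡ e′))

  module Cut {h} (ah : Affine h) (h-Y : ∀ x → Y x ≡ true → h x ≡ true)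
    (h-Z′ : ∀ x → Z (x ⊞ (t ⊞ r)) ≡ true → h x ≡ true) (ht : h t ≡ false) where

    hr : h r ≡ true
    hr = h-Y r (∧-true r₀ r₂)

    h-Z : ∀ x → Z x ≡ true → h x ≡ false
    h-Z x e = trans (cong h (⊞-solve (x ∷ t ∷ r ∷ []) x₀ (x₀ ⊕ (x₁ ⊕ x₂) ⊕ x₁ ⊕ x₂) refl))
      (trans (at-sum ah (x ⊞ (t ⊞ r)) t r)
        (cong₂ _xor_ (h-Z′ _ (on Z (⊞-solve (x ∷ t ∷ r ∷ []) x₀ (x₀ ⊕ (x₁ ⊕ x₂) ⊕ (x₁ ⊕ x₂)) refl) e))
          (cong₂ _xor_ ht hr)))

    H₀ F₀ : Fun n
    H₀ = L₀ ∧ᶠ h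
    c : Vec Bool n
    c = p ⊞ r
    F₀ = D c H₀

    wt-H₀ : 2 * wt H₀ ≡ 2 ^ s
    wt-H₀ = trans (flat-half φ₀ ah r₀ hr t₀ ht) (proj₂ fl₀)

    F₀-small : Small s F₀
    F₀-small = I-F₀ s (proj₁ (flat-small s fl₀)) , (begin
      wt F₀                                    ≤⟨ m≤m+n (wt F₀) _ ⟩
      wt F₀ + 2 * wt (H₀ ∧ᶠ shift c H₀)        ≡⟨ wt-+ H₀ (shift c H₀) ⟩
      wt H₀ + wt (shift c H₀)                  ≡⟨ cong (wt H₀ +_) (trans (wt-shift c H₀) (sym (+-identityʳ _))) ⟩
      2 * wt H₀                                ≡⟨ wt-H₀ ⟩
      2 ^ s                                    ∎)
      where
      open ≤-Reasoning
      I-F₀ : ∀ s → I s L₀ → I s F₀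
      I-F₀ zero _ = tt
      I-F₀ (suc s) (_ , k) = I-D s c (k h ah)

    F₀-H₀ : ∀ x → L₀ x ≡ true → h x ≡ true → F₀ x ≡ true
    F₀-H₀ x e hx = cong₂ _xor_ (∧-true e hx) (cong (_∧ h (x ⊞ c)) (¬-not (outside r₀ e)))

    F₀-shift : ∀ x → L₀ (x ⊞ c) ≡ true → h (x ⊞ c) ≡ true → F₀ x ≡ true
    F₀-shift x e hx = cong₂ _xor_ (cong (_∧ h x) (¬-not λ e′ → outside r₀ e′ e)) (∧-true e hx)

    A B : Fun n
    A = F₀ +ᶠ L₀ +ᶠ L₁
    B = F₀ +ᶠ L₂

    F₀L₀-small : Small s (F₀ +ᶠ L₀)
    F₀L₀-small = small-sum s F₀-small (flat-small s fl₀) (≤-trans (≤-reflexive (sym wt-H₀))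
      (*-monoʳ-≤ 2 (wt-mono λ x e → ∧-true (F₀-H₀ x (∧-trueˡ e) (∧-trueʳ {L₀ x} e)) (∧-trueˡ e))))

    -- `F₀ +ᶠ L₀` consists of the half of `L₀` outside `H₀` and of the translate of `H₀` by `c`. It
    -- contains `Z` and the disjoint translate of `Z` by `p ⊞ t`; both lie in `L₁` and together make
    -- up half of its size.
    A-small : Small s A
    A-small = small-sum s F₀L₀-small (flat-small s fl₁)
        (≤-trans (≤-reflexive (trans (sym quarter₁) (*-assoc 2 2 (wt Z))))
      (*-monoʳ-≤ 2 (wt-two-copies Z ((F₀ +ᶠ L₀) ∧ᶠ L₁) (p ⊞ t)
        (λ x e → ∧-true (cong₂ _xor_ (cong₂ _xor_ (trans (cong (L₀ x ∧_) (h-Z x e)) (∧-zeroʳ (L₀ x)))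
            (cong (_∧ h (x ⊞ c)) (¬-not (outside r₀ (∧-trueˡ e))))) (∧-trueˡ e)) (∧-trueʳ {L₀ x} e))
        (λ x e → let
            xc₀ = on L₀ (⊞-solve (x ∷ p ∷ t ∷ r ∷ []) (x₀ ⊕ (x₁ ⊕ x₂) ⊕ x₂ ⊕ x₃) (x₀ ⊕ (x₁ ⊕ x₃)) refl)
              (closed φ₀ (∧-trueˡ e) t₀ r₀)
            hxc = h-Z′ (x ⊞ c) (on Z (⊞-solve (x ∷ p ∷ t ∷ r ∷ []) (x₀ ⊕ (x₁ ⊕ x₂))
                (x₀ ⊕ (x₁ ⊕ x₃) ⊕ (x₂ ⊕ x₃)) refl) e)
          in ∧-true (cong₂ _xor_ (F₀-shift x xc₀ hxc) (¬-not λ e′ → outside r₀ e′ xc₀))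
            (on L₁ (⊞-solve (x ∷ p ∷ t ∷ []) (x₀ ⊕ (x₁ ⊕ x₂) ⊕ x₁ ⊕ x₂) x₀ refl)
                (closed φ₁ (∧-trueʳ {L₀ (x ⊞ (p ⊞ t))} e) p₁ t₁)))
        (λ x e e′ → outside t₀ (∧-trueˡ e) (∧-trueˡ e′)))))

    -- Here `Y` and its translate by `c` are the two quarters, both in `F₀` and in `L₂`.
    B-small : Small s B
    B-small = small-sum s F₀-small (flat-small s fl₂)
        (≤-trans (≤-reflexive (trans (sym quarter₂) (*-assoc 2 2 (wt Y))))
      (*-monoʳ-≤ 2 (wt-two-copies Y (F₀ ∧ᶠ L₂) c
        (λ x e → ∧-true (F₀-H₀ x (∧-trueˡ e) (h-Y x e)) (∧-trueʳ {L₀ x} e))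
        (λ x e → ∧-true (F₀-shift x (∧-trueˡ e) (h-Y _ e))
          (on L₂ (⊞-solve (x ∷ p ∷ r ∷ []) (x₀ ⊕ (x₁ ⊕ x₂) ⊕ x₁ ⊕ x₂) x₀ refl)
              (closed φ₂ (∧-trueʳ {L₀ (x ⊞ c)} e) p₂ r₂)))
        (λ x e e′ → outside r₀ (∧-trueˡ e) (∧-trueˡ e′)))))

    regrouped : (L₀ +ᶠ L₁ +ᶠ L₂) ≗ (A +ᶠ B)
    regrouped x = pt (L₀ x) (L₁ x) (L₂ x) (F₀ x)
      where
      pt : ∀ a b d f → (a xor b) xor d ≡ ((f xor a) xor b) xor (f xor d)
      pt a b d f = cong head (⊞-solve ((a ∷ []) ∷ (b ∷ []) ∷ (d ∷ []) ∷ (f ∷ []) ∷ [])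
        (x₀ ⊕ x₁ ⊕ x₂) (x₃ ⊕ x₀ ⊕ x₁ ⊕ (x₃ ⊕ x₂)) refl)

  regroup : ∃[ A ] ∃[ B ] (Small s A × Small s B × (L₀ +ᶠ L₁ +ᶠ L₂) ≗ (A +ᶠ B))
  regroup with h , ah , h-Y , h-Z′ , ht ← separation = A , B , A-small , B-small , regrouped
    where open Cut ah h-Y h-Z′ ht

-- In the second case M has dimension s + 2, so f is a polynomial of degree at most 2 on M.
data Shape {n} (s : ℕ) (f : Fun n) : Set where
  two-flats : ∀ {X Y} → Small s X → Small s Y → f ≗ (X +ᶠ Y) → Shape s f
  quadric   : ∀ {M} → Flat M → wt M ≡ 4 * 2 ^ s → (∀ x → f x ≡ true → M x ≡ true) →
    3 * 2 ^ s < 2 * wt f → Shape s f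

shape-cong : ∀ {n s} {f g : Fun n} → f ≗ g → Shape s f → Shape s g
shape-cong e (two-flats a b d) = two-flats a b (λ x → trans (sym (e x)) (d x))
shape-cong {s = s} e (quadric φ w c big) =
  quadric φ w (λ x gx → c x (trans (e x) gx)) (subst (λ t → 3 * 2 ^ s < 2 * t) (wt-cong e) big)

-- Sums of three flats

∧-dup : ∀ a b c → (a ∧ b) ∧ (a ∧ c) ≡ (a ∧ b) ∧ c
∧-dup true b c = refl
∧-dup false b c = refl

∧-dupʳ : ∀ a b c → (a ∧ c) ∧ (b ∧ c) ≡ (a ∧ b) ∧ c
∧-dupʳ true true true = refl
∧-dupʳ true true false = refl
∧-dupʳ true false c = ∧-zeroʳ c
∧-dupʳ false b c = refl

wt-+₃ : ∀ {n} (f g h : Fun n) →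
  wt (f +ᶠ g +ᶠ h) + 2 * (wt (f ∧ᶠ g) + wt (f ∧ᶠ h) + wt (g ∧ᶠ h)) ≡ wt f + wt g + wt h + 4 * wt (f ∧ᶠ g ∧ᶠ h)
wt-+₃ f g h = ar (wt (f +ᶠ g +ᶠ h)) (wt (f +ᶠ g)) (wt f) (wt g) (wt h) (wt (f ∧ᶠ g)) (wt (f ∧ᶠ h)) (wt (g ∧ᶠ h))
    (wt (f ∧ᶠ g ∧ᶠ h)) (wt ((f +ᶠ g) ∧ᶠ h)) (wt-+ (f +ᶠ g) h) (wt-+ f g) d
  where
  d : wt ((f +ᶠ g) ∧ᶠ h) + 2 * wt (f ∧ᶠ g ∧ᶠ h) ≡ wt (f ∧ᶠ h) + wt (g ∧ᶠ h)
  d = trans (cong₂ (λ a b → a + 2 * b) (wt-cong λ x → ∧-distribʳ-xor (h x) (f x) (g x))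
      (wt-cong λ x → sym (∧-dupʳ (f x) (g x) (h x))))
    (wt-+ (f ∧ᶠ h) (g ∧ᶠ h))
  ar : ∀ W e F G H a b c τ δ → W + 2 * δ ≡ e + H → e + 2 * a ≡ F + G → δ + 2 * τ ≡ b + c →
    W + 2 * (a + b + c) ≡ F + G + H + 4 * τ
  ar W e F G H a b c τ δ p q r = begin
    W + 2 * (a + b + c)              ≡⟨ i₁ W a b c ⟩
    W + 2 * a + 2 * (b + c)          ≡⟨ cong (λ t → W + 2 * a + 2 * t) r ⟨
    W + 2 * a + 2 * (δ + 2 * τ)      ≡⟨ i₂ W a δ τ ⟩
    (W + 2 * δ) + 2 * a + 4 * τ      ≡⟨ cong (λ t → t + 2 * a + 4 * τ) p ⟩
    e + H + 2 * a + 4 * τ            ≡⟨ i₃ e H a τ ⟩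
    (e + 2 * a) + H + 4 * τ          ≡⟨ cong (λ t → t + H + 4 * τ) q ⟩
    F + G + H + 4 * τ                ∎
    where
    open ≡-Reasoning
    i₁ : ∀ W a b c → W + 2 * (a + b + c) ≡ W + 2 * a + 2 * (b + c)
    i₁ = solve-∀
    i₂ : ∀ W a δ τ → W + 2 * a + 2 * (δ + 2 * τ) ≡ (W + 2 * δ) + 2 * a + 4 * τ
    i₂ = solve-∀
    i₃ : ∀ e H a τ → e + H + 2 * a + 4 * τ ≡ (e + 2 * a) + H + 4 * τ
    i₃ = solve-∀

power-2* : ∀ {a} → IsPower a → IsPower (2 * a)
power-2* (e , refl) = suc e , refl

module _ {n} s {L₀ L₁ L₂ : Fun n} (fl₀ : IsFlat s L₀) (fl₁ : IsFlat s L₁) (fl₂ : IsFlat s L₂)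
  (quarter₁ : 4 * wt (L₀ ∧ᶠ L₁) ≡ 2 ^ s) (quarter₂ : 4 * wt (L₀ ∧ᶠ L₂) ≡ 2 ^ s)
  (main : 2 ^ s + 4 * wt (L₀ ∧ᶠ L₁ ∧ᶠ L₂) < 2 * (wt (L₀ ∧ᶠ L₁) + wt (L₀ ∧ᶠ L₂) + wt (L₁ ∧ᶠ L₂)))
  (c≤ : 4 * wt (L₁ ∧ᶠ L₂) ≤ 2 ^ s) where

  private
    q a b c τ : ℕ
    q = 2 ^ s
    a = wt (L₀ ∧ᶠ L₁)
    b = wt (L₀ ∧ᶠ L₂)
    c = wt (L₁ ∧ᶠ L₂)
    τ = wt (L₀ ∧ᶠ L₁ ∧ᶠ L₂)

    instance
      q≢0 : NonZero q
      q≢0 = >-nonZero (m^n>0 2 s)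

  -- The dimension formula inside `L₀` gives `q ≤ 16 * τ`, while `main` gives `2 * τ < c` and
  -- doubling gives `4 * τ ≤ c`. With `c≤` this forces `16 * τ ≡ q` and `4 * c ≡ q`. Hence `L₂` is
  -- spanned by its intersections with `L₀` and `L₁` and lies in their hull, which has `4 * q`
  -- points; the weight is seven quarters of `q`.
  concurrent-quarters : ∀ {p} → L₀ p ≡ true → L₁ p ≡ true → L₂ p ≡ true → Shape s (L₀ +ᶠ L₁ +ᶠ L₂)
  concurrent-quarters {p} p₀ p₁ p₂ = quadric M-flat wt-M support heavy
    where
    φ₀ = proj₁ fl₀
    φ₁ = proj₁ fl₁
    φ₂ = proj₁ fl₂
    M N : Fun n
    M = hull L₀ L₁ p
    N = hull (L₀ ∧ᶠ L₂) (L₁ ∧ᶠ L₂) p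
    M-flat = hull-flat φ₀ φ₁ p₀ p₁

    ab≤qτ : a * b ≤ q * τ
    ab≤qτ = begin
      a * b
          ≡⟨ hull-wt (flat-∧ φ₀ φ₁) (flat-∧ φ₀ φ₂) (∧-true p₀ p₁) (∧-true p₀ p₂) ⟨
      wt (hull (L₀ ∧ᶠ L₁) (L₀ ∧ᶠ L₂) p) * wt ((L₀ ∧ᶠ L₁) ∧ᶠ (L₀ ∧ᶠ L₂))
        ≤⟨ *-mono-≤ (wt-mono (hull-⊆ (flat-∧ φ₀ φ₁) (flat-∧ φ₀ φ₂) (∧-true p₀ p₁) (∧-true p₀ p₂) φ₀
            (λ _ → ∧-trueˡ) (λ _ → ∧-trueˡ)))
             (≤-reflexive (wt-cong λ x → ∧-dup (L₀ x) (L₁ x) (L₂ x))) ⟩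
      wt L₀ * τ                                           ≡⟨ cong (_* τ) (proj₂ fl₀) ⟩
      q * τ                                               ∎
      where open ≤-Reasoning

    q≤16τ : q ≤ 16 * τ
    q≤16τ = *-cancelˡ-≤ q (begin
      q * q                ≡⟨ cong₂ _*_ quarter₁ quarter₂ ⟨
      4 * a * (4 * b)      ≡⟨ ar a b ⟩
      16 * (a * b)         ≤⟨ *-monoʳ-≤ 16 ab≤qτ ⟩
      16 * (q * τ)         ≡⟨ ar′ q τ ⟩
      q * (16 * τ)         ∎)
      where
      open ≤-Reasoning
      ar : ∀ a b → 4 * a * (4 * b) ≡ 16 * (a * b)
      ar = solve-∀
      ar′ : ∀ q τ → 16 * (q * τ) ≡ q * (16 * τ)
      ar′ = solve-∀

    4τ≤c : 2 * (2 * τ) ≤ c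
    4τ≤c = power-< (power-2* (flat-wt (flat-∧ (flat-∧ φ₀ φ₁) φ₂) (∧-true (∧-true p₀ p₁) p₂)))
        (flat-wt (flat-∧ φ₁ φ₂) (∧-true p₁ p₂))
      (*-cancelˡ-< 4 (2 * τ) c (lin≤ 1 (+-mono-≤ (*-monoʳ-≤ 2 main) (≤-reflexive (cong₂ _+_ quarter₁ quarter₂)))
          (ar q a b c τ)))
      where
      ar : ∀ q a b c τ → suc (4 * (2 * τ)) + (2 * (2 * (a + b + c)) + (q + q)) + 1 ≡ 4 * c +
          (2 * suc (q + 4 * τ) + (4 * a + 4 * b))
      ar = solve-∀

    16τ≤4c : 16 * τ ≤ 4 * c
    16τ≤4c = ≤-trans (≤-reflexive (ar τ)) (*-monoʳ-≤ 4 4τ≤c)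
      where
      ar : ∀ τ → 16 * τ ≡ 4 * (2 * (2 * τ))
      ar = solve-∀

    16τ≡q : 16 * τ ≡ q
    16τ≡q = ≤-antisym (≤-trans 16τ≤4c c≤) q≤16τ

    4c≡q : 4 * c ≡ q
    4c≡q = ≤-antisym c≤ (≤-trans q≤16τ 16τ≤4c)

    wt-N : wt N ≡ q
    wt-N = *-cancelʳ-≡ (wt N) q q (begin
      wt N * q            ≡⟨ cong (wt N *_) 16τ≡q ⟨
      wt N * (16 * τ)     ≡⟨ ar (wt N) τ ⟩
      16 * (wt N * τ)     ≡⟨ cong (λ t → 16 * (wt N * t)) (wt-cong λ x → ∧-dupʳ (L₀ x) (L₁ x) (L₂ x)) ⟨
      16 * (wt N * wt ((L₀ ∧ᶠ L₂) ∧ᶠ (L₁ ∧ᶠ L₂)))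
                          ≡⟨ cong (16 *_) (hull-wt (flat-∧ φ₀ φ₂) (flat-∧ φ₁ φ₂) (∧-true p₀ p₂) (∧-true p₁ p₂)) ⟩
      16 * (b * c)        ≡⟨ ar′ b c ⟩
      4 * b * (4 * c)     ≡⟨ cong₂ _*_ quarter₂ 4c≡q ⟩
      q * q               ∎)
      where
      open ≡-Reasoning
      ar : ∀ m a → m * (16 * a) ≡ 16 * (m * a)
      ar = solve-∀
      ar′ : ∀ b c → 16 * (b * c) ≡ 4 * b * (4 * c)
      ar′ = solve-∀

    L₂⊆M : ∀ x → L₂ x ≡ true → M x ≡ true
    L₂⊆M x e = hull-⊆ (flat-∧ φ₀ φ₂) (flat-∧ φ₁ φ₂) (∧-true p₀ p₂) (∧-true p₁ p₂) M-flat
      (λ y e → hull-⊇ˡ φ₀ φ₁ p₀ p₁ y (∧-trueˡ e)) (λ y e → hull-⊇ʳ φ₀ φ₁ p₀ p₁ y (∧-trueˡ e)) x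
      (wt-⊆-≥ {f = N} {L₂} (hull-⊆ (flat-∧ φ₀ φ₂) (flat-∧ φ₁ φ₂) (∧-true p₀ p₂) (∧-true p₁ p₂) φ₂
          (λ y → ∧-trueʳ {L₀ y}) (λ y → ∧-trueʳ {L₁ y}))
        (≤-reflexive (trans (proj₂ fl₂) (sym wt-N))) x e)

    support : ∀ x → (L₀ +ᶠ L₁ +ᶠ L₂) x ≡ true → M x ≡ true
    support x e with L₀ x in e₀ | L₁ x in e₁ | L₂ x in e₂
    ... | true  | _     | _    = hull-⊇ˡ φ₀ φ₁ p₀ p₁ x e₀
    ... | false | true  | _    = hull-⊇ʳ φ₀ φ₁ p₀ p₁ x e₁
    ... | false | false | true = L₂⊆M x e₂

    wt-M : wt M ≡ 4 * q
    wt-M = *-cancelʳ-≡ (wt M) (4 * q) q (begin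
      wt M * q         ≡⟨ cong (wt M *_) quarter₁ ⟨
      wt M * (4 * a)   ≡⟨ ar (wt M) a ⟩
      4 * (wt M * a)   ≡⟨ cong (4 *_) (trans (hull-wt φ₀ φ₁ p₀ p₁) (cong₂ _*_ (proj₂ fl₀) (proj₂ fl₁))) ⟩
      4 * (q * q)      ≡⟨ *-assoc 4 q q ⟨
      4 * q * q        ∎)
      where
      open ≡-Reasoning
      ar : ∀ m a → m * (4 * a) ≡ 4 * (m * a)
      ar = solve-∀

    heavy : 3 * q < 2 * wt (L₀ +ᶠ L₁ +ᶠ L₂)
    heavy = *-cancelˡ-< 2 (3 * q) _ (lin≤ 0 (+-mono-≤
        (+-mono-≤ (*-monoʳ-≤ 4 (≤-reflexive weight))
            (*-monoʳ-≤ 2 (≤-reflexive (cong₂ _+_ (cong₂ _+_ quarter₁ quarter₂) 4c≡q)))) (+-mono-≤ q≤16τ (m^n>0 2 s)))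
        (ar (wt (L₀ +ᶠ L₁ +ᶠ L₂)) q a b c τ))
      where
      weight : q + q + q + 4 * τ ≡ wt (L₀ +ᶠ L₁ +ᶠ L₂) + 2 * (a + b + c)
      weight = sym (trans (wt-+₃ L₀ L₁ L₂) (cong (_+ 4 * τ)
          (cong₂ _+_ (cong₂ _+_ (proj₂ fl₀) (proj₂ fl₁)) (proj₂ fl₂))))
      ar : ∀ W q a b c τ → suc (2 * (3 * q)) + ((4 * (W + 2 * (a + b + c)) + 2 * (q + q + q)) + (16 * τ + q)) + 0
        ≡ 2 * (2 * W) + ((4 * (q + q + q + 4 * τ) + 2 * (4 * a + 4 * b + 4 * c)) + (q + 1))
      ar = solve-∀

  quarters : 1 ≤ c → Shape s (L₀ +ᶠ L₁ +ᶠ L₂)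
  quarters c>0 = cases (search (L₀ ∧ᶠ L₁ ∧ᶠ L₂))
    where
    disjoint : ∃[ p ] (L₁ ∧ᶠ L₂) p ≡ true → ∃[ t ] (L₀ ∧ᶠ L₁) t ≡ true → ∃[ r ] (L₀ ∧ᶠ L₂) r ≡ true →
      (∀ x → L₀ x ≡ true → L₁ x ≡ true → L₂ x ≡ true → ⊥) → Shape s (L₀ +ᶠ L₁ +ᶠ L₂)
    disjoint (p , pe) (t , te) (r , re) none =
      let A , B , A-small , B-small , e = regroup in two-flats A-small B-small e
      where
      open Regroup s fl₀ fl₁ fl₂ quarter₁ quarter₂
        {p} {t} {r} (∧-trueˡ pe) (∧-trueʳ {L₁ p} pe) (∧-trueˡ te) (∧-trueʳ {L₀ t} te) (∧-trueˡ re)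
            (∧-trueʳ {L₀ r} re) none
    cases : (∃[ x ] (L₀ ∧ᶠ L₁ ∧ᶠ L₂) x ≡ true) ⊎ (∀ x → (L₀ ∧ᶠ L₁ ∧ᶠ L₂) x ≡ false) → Shape s (L₀ +ᶠ L₁ +ᶠ L₂)
    cases (inj₁ (p , e)) = concurrent-quarters {p} (∧-trueˡ (∧-trueˡ e)) (∧-trueʳ {L₀ p} (∧-trueˡ e))
        (∧-trueʳ {L₀ p ∧ L₁ p} e)
    cases (inj₂ none) = disjoint (wt-pos c>0) (wt-pos (quarter-pos s quarter₁)) (wt-pos (quarter-pos s quarter₂))
      (λ x x₀ x₁ x₂ → true≢false (∧-true (∧-true x₀ x₁) x₂) (none x))

wt-∧-comm : ∀ {n} (f g : Fun n) → wt (f ∧ᶠ g) ≡ wt (g ∧ᶠ f)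
wt-∧-comm f g = wt-cong λ x → ∧-comm (f x) (g x)

flats-meet : ∀ {n} s {X Y : Fun n} → IsFlat s X → IsFlat s Y → wt (X ∧ᶠ Y) ≡ 0 ⊎ IsPower (wt (X ∧ᶠ Y))
flats-meet s {X} {Y} (φ , _) (χ , _) with search (X ∧ᶠ Y)
... | inj₁ (p , e) = inj₂ (flat-wt (flat-∧ φ χ) e)
... | inj₂ none = inj₁ (wt-empty none)

below-half : ∀ s {x} → x ≡ 0 ⊎ IsPower x → 2 * x < 2 ^ s → 4 * x ≤ 2 ^ s
below-half s (inj₁ refl) _ = z≤n
below-half s {x} (inj₂ π) lt = ≤-trans (≤-reflexive (*-assoc 2 2 x)) (power-< (power-2* π) (s , refl) lt)

below-quarter : ∀ s {x} → x ≡ 0 ⊎ IsPower x → 4 * x ≤ 2 ^ s → 4 * x ≢ 2 ^ s → 8 * x ≤ 2 ^ s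
below-quarter s (inj₁ refl) _ _ = z≤n
below-quarter s {x} (inj₂ π) le ne = ≤-trans (≤-reflexive (*-assoc 2 4 x))
  (power-< (subst IsPower (sym (*-assoc 2 2 x)) (power-2* (power-2* π))) (s , refl) (≤∧≢⇒< le ne))

-- Two flats that meet in at least half merge. Otherwise every intersection has at most a quarter of
-- `q` points, and by inclusion-exclusion lightness makes the three intersections exceed `q / 2` in
-- total. So at most one is as small as an eighth, two are exact quarters, and the flat common to
-- these two takes the role of `L₀`; the third intersection is still nonempty.
three-flats : ∀ {n} s {L₀ L₁ L₂ : Fun n} → IsFlat s L₀ → IsFlat s L₁ → IsFlat s L₂ →
  wt (L₀ +ᶠ L₁ +ᶠ L₂) < 2 * 2 ^ s → Shape s (L₀ +ᶠ L₁ +ᶠ L₂)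
three-flats {n} s {L₀} {L₁} {L₂} fl₀ fl₁ fl₂ light = halves (q ≤? 2 * a) (q ≤? 2 * b) (q ≤? 2 * c)
  where
  q = 2 ^ s
  a = wt (L₀ ∧ᶠ L₁)
  b = wt (L₀ ∧ᶠ L₂)
  c = wt (L₁ ∧ᶠ L₂)
  τ = wt (L₀ ∧ᶠ L₁ ∧ᶠ L₂)

  inequality : ∀ {X Y Z : Fun n} → IsFlat s X → IsFlat s Y → IsFlat s Z → wt (X +ᶠ Y +ᶠ Z) < 2 * 2 ^ s →
    2 ^ s + 4 * wt (X ∧ᶠ Y ∧ᶠ Z) < 2 * (wt (X ∧ᶠ Y) + wt (X ∧ᶠ Z) + wt (Y ∧ᶠ Z))
  inequality {X} {Y} {Z} (_ , x) (_ , y) (_ , z) light = lin≤ 0 (+-mono-≤ light (≤-reflexive weight))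
    (ar (wt (X +ᶠ Y +ᶠ Z)) q (wt (X ∧ᶠ Y) + wt (X ∧ᶠ Z) + wt (Y ∧ᶠ Z)) (wt (X ∧ᶠ Y ∧ᶠ Z)))
    where
    weight : q + q + q + 4 * wt (X ∧ᶠ Y ∧ᶠ Z) ≡ wt (X +ᶠ Y +ᶠ Z) + 2 * (wt (X ∧ᶠ Y) + wt (X ∧ᶠ Z) + wt (Y ∧ᶠ Z))
    weight = sym (trans (wt-+₃ X Y Z) (cong (_+ 4 * wt (X ∧ᶠ Y ∧ᶠ Z)) (cong₂ _+_ (cong₂ _+_ x y) z)))
    ar : ∀ W q m τ → suc (q + 4 * τ) + (2 * q + (W + 2 * m)) + 0 ≡ 2 * m + (suc W + (q + q + q + 4 * τ))
    ar = solve-∀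

  main : q + 4 * τ < 2 * (a + b + c)
  main = inequality fl₀ fl₁ fl₂ light

  swap₀₁ : (L₁ +ᶠ L₀ +ᶠ L₂) ≗ (L₀ +ᶠ L₁ +ᶠ L₂)
  swap₀₁ x = cong (_xor L₂ x) (xor-comm (L₁ x) (L₀ x))
  rotate : (L₂ +ᶠ L₀ +ᶠ L₁) ≗ (L₀ +ᶠ L₁ +ᶠ L₂)
  rotate x = trans (xor-assoc (L₂ x) (L₀ x) (L₁ x)) (xor-comm (L₂ x) _)
  light-cong : ∀ {g : Fun n} → g ≗ (L₀ +ᶠ L₁ +ᶠ L₂) → wt g < 2 * 2 ^ s
  light-cong e = subst (_< 2 * 2 ^ s) (sym (wt-cong e)) light

  module _ (a≤ : 4 * a ≤ q) (b≤ : 4 * b ≤ q) (c≤ : 4 * c ≤ q) where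

    positive : ∀ {q} a b c τ → q + 4 * τ < 2 * (a + b + c) → 4 * b ≤ q → 4 * c ≤ q → 1 ≤ a
    positive {q} a b c τ main b≤ c≤ = ≰⇒> λ a≤0 →
      lin⊥ (1 + 8 * τ) (+-mono-≤ (*-monoʳ-≤ 2 main) (+-mono-≤ (+-mono-≤ b≤ c≤) (*-monoʳ-≤ 4 a≤0))) (ar q a b c τ)
      where
      ar : ∀ q a b c τ → 2 * suc (q + 4 * τ) + (4 * b + 4 * c + 4 * a) ≡ suc
          (2 * (2 * (a + b + c)) + (q + q + 4 * 0) + (1 + 8 * τ))
      ar = solve-∀

    two-eighths : ∀ {q} a b c τ → q + 4 * τ < 2 * (a + b + c) → 8 * a ≤ q → 8 * b ≤ q → 4 * c ≤ q → ⊥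
    two-eighths {q} a b c τ main a≤ b≤ c≤ =
      lin⊥ (3 + 16 * τ) (+-mono-≤ (*-monoʳ-≤ 4 main) (+-mono-≤ (+-mono-≤ a≤ b≤) (*-monoʳ-≤ 2 c≤))) (ar q a b c τ)
      where
      ar : ∀ q a b c τ → 4 * suc (q + 4 * τ) + (8 * a + 8 * b + 2 * (4 * c)) ≡ suc
          (4 * (2 * (a + b + c)) + (q + q + 2 * q) + (3 + 16 * τ))
      ar = solve-∀

    b+a+c : ∀ a b c → a + b + c ≡ b + a + c
    b+a+c a b c = cong (_+ c) (+-comm a b)
    c+a+b : ∀ a b c → a + b + c ≡ c + a + b
    c+a+b a b c = trans (+-comm (a + b) c) (sym (+-assoc c a b))

    permuted : ∀ {m} → a + b + c ≡ m → q + 4 * τ < 2 * m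
    permuted refl = main

    quarter-cases : Dec (4 * a ≡ q) → Dec (4 * b ≡ q) → Dec (4 * c ≡ q) → Shape s (L₀ +ᶠ L₁ +ᶠ L₂)
    quarter-cases (yes a≡) (yes b≡) _ = quarters s fl₀ fl₁ fl₂ a≡ b≡ main c≤
        (positive c a b τ (permuted (c+a+b a b c)) a≤ b≤)
    quarter-cases (yes a≡) (no _) (yes c≡) = shape-cong swap₀₁
      (quarters s fl₁ fl₀ fl₂ (trans (cong (4 *_) (wt-∧-comm L₁ L₀)) a≡) c≡
          (inequality fl₁ fl₀ fl₂ (light-cong swap₀₁)) b≤
        (positive b a c τ (permuted (b+a+c a b c)) a≤ c≤))
    quarter-cases (no _) (yes b≡) (yes c≡) = shape-cong rotate
      (quarters s fl₂ fl₀ fl₁ (trans (cong (4 *_) (wt-∧-comm L₂ L₀)) b≡) (trans (cong (4 *_) (wt-∧-comm L₂ L₁)) c≡)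
        (inequality fl₂ fl₀ fl₁ (light-cong rotate)) a≤ (positive a b c τ main b≤ c≤))
    quarter-cases (no a≢) (no b≢) _ = ⊥-elim (two-eighths a b c τ main
      (below-quarter s (flats-meet s fl₀ fl₁) a≤ a≢) (below-quarter s (flats-meet s fl₀ fl₂) b≤ b≢) c≤)
    quarter-cases (no a≢) (yes _) (no c≢) = ⊥-elim (two-eighths c a b τ (permuted (c+a+b a b c))
      (below-quarter s (flats-meet s fl₁ fl₂) c≤ c≢) (below-quarter s (flats-meet s fl₀ fl₁) a≤ a≢) b≤)
    quarter-cases (yes _) (no b≢) (no c≢) = ⊥-elim (two-eighths c b a τ
        (permuted (trans (c+a+b a b c) (trans (+-assoc c a b)
            (trans (cong (c +_) (+-comm a b)) (sym (+-assoc c b a))))))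
      (below-quarter s (flats-meet s fl₁ fl₂) c≤ c≢) (below-quarter s (flats-meet s fl₀ fl₂) b≤ b≢) a≤)

  halves : Dec (q ≤ 2 * a) → Dec (q ≤ 2 * b) → Dec (q ≤ 2 * c) → Shape s (L₀ +ᶠ L₁ +ᶠ L₂)
  halves (yes a≥) _ _ = two-flats (small-sum s (flat-small s fl₀) (flat-small s fl₁) a≥) (flat-small s fl₂)
      (λ _ → refl)
  halves (no _) (yes b≥) _ = two-flats (small-sum s (flat-small s fl₀) (flat-small s fl₂) b≥) (flat-small s fl₁)
    (λ x → trans (xor-assoc (L₀ x) _ _) (trans (cong (L₀ x xor_) (xor-comm (L₁ x) _)) (sym (xor-assoc (L₀ x) _ _))))
  halves (no _) (no _) (yes c≥) = two-flats (flat-small s fl₀)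
      (small-sum s (flat-small s fl₁) (flat-small s fl₂) c≥) (λ x → xor-assoc (L₀ x) _ _)
  halves (no a<) (no b<) (no c<) = quarter-cases
    (below-half s (flats-meet s fl₀ fl₁) (≰⇒> a<)) (below-half s (flats-meet s fl₀ fl₂) (≰⇒> b<))
        (below-half s (flats-meet s fl₁ fl₂) (≰⇒> c<)) (4 * a ≟ q) (4 * b ≟ q) (4 * c ≟ q)

⊞-cancelˡ : ∀ {n} (x u : Vec Bool n) → x ⊞ (x ⊞ u) ≡ u
⊞-cancelˡ x u = ⊞-solve (x ∷ u ∷ []) (x₀ ⊕ (x₀ ⊕ x₁)) x₁ refl

-- Words supported on a flat of size 2 ^ (s + 2)

-- Descent: `d` is even, and halving it removes two factors from the square.
square-power : ∀ k {d} → d * d ≡ 2 ^ k → IsPower d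
square-power k {d} e with euclidsLemma d d prime[2]
square-power zero {d} e | _ = 0 , m*n≡1⇒m≡1 d d e
square-power (suc k) {d} e | lemma = even-case k e (both (lemma (subst (2 ∣_) (sym e) (m∣m*n (2 ^ k)))))
  where
  both : (2 ∣ d) ⊎ (2 ∣ d) → 2 ∣ d
  both (inj₁ x) = x
  both (inj₂ x) = x
  ar : ∀ m → m * 2 * (m * 2) ≡ 2 * (2 * (m * m))
  ar = solve-∀
  2*m≢1 : ∀ m → 2 * m ≢ 1
  2*m≢1 (suc m) e with () ← trans (sym (+-suc m (m + 0))) (suc-injective e)
  even-case : ∀ k {d} → d * d ≡ 2 ^ suc k → 2 ∣ d → IsPower d
  even-case zero e (divides m refl) = ⊥-elim (2*m≢1 (m * m) (*-cancelˡ-≡ _ _ 2 (trans (sym (ar m)) e)))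
  even-case (suc k) e (divides m refl) with x , y ← square-power k {m}
      (*-cancelˡ-≡ _ _ 2 (*-cancelˡ-≡ _ _ 2 (trans (sym (ar m)) e))) =
    suc x , trans (*-comm m 2) (cong (2 *_) y)

module OnFlat {n} s {f M : Fun n} (i : I s f) (φ : Flat M) (wM : wt M ≡ 4 * 2 ^ s)
  (f⊆M : ∀ x → f x ≡ true → M x ≡ true) where

  private
    q w : ℕ
    q = 2 ^ s
    w = wt f

  M-code : I (suc (suc s)) M
  M-code = I-flat (suc (suc s)) φ (≤-reflexive (trans (sym (*-assoc 2 2 q)) (sym wM)))

  D-⊆ : ∀ {g u} → (∀ x → g x ≡ true → M x ≡ true) → (∀ x → M (x ⊞ u) ≡ M x) → ∀ x → D u g x ≡ true → M x ≡ true
  D-⊆ {g} {u} g⊆M inv x e with g x in gx | g (x ⊞ u) in gxu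
  ... | true | _ = g⊆M x gx
  ... | false | true = trans (sym (inv x)) (g⊆M _ gxu)

  wt-D : ∀ u → wt (D u f) + 2 * wt (f ∧ᶠ shift u f) ≡ 2 * w
  wt-D u = trans (wt-+ f (shift u f)) (cong (w +_) (trans (wt-shift u f) (sym (+-identityʳ w))))

  -- Both `D u f` and its complement in `M` are words of minimum distance `2 * q`, and together they
  -- fill the `4 * q` points of `M`. The complement cannot be empty, since `D u f` has at most
  -- `2 * w` points.
  derivative-weight : w < 2 * q → ∀ {u p} → (∀ x → M (x ⊞ u) ≡ M x) → D u f p ≡ true → wt (D u f) ≡ 2 * q
  derivative-weight light {u} {p} inv Dp = ≤-antisym (cases (search (M +ᶠ D u f))) (min-weight (suc s) (I-D s u i) Dp)
    where
    total : wt (M +ᶠ D u f) + wt (D u f) ≡ 4 * q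
    total = +-cancelʳ-≡ (wt (D u f)) _ _ (trans (ar (wt (M +ᶠ D u f)) (wt (D u f)))
      (trans (cong (λ t → wt (M +ᶠ D u f) + 2 * t) (wt-cong λ x → bool-ext
          (λ e → ∧-true (D-⊆ {f} f⊆M inv x e) e) (∧-trueʳ {M x})))
        (trans (wt-+ M (D u f)) (cong (_+ wt (D u f)) wM))))
      where
      ar : ∀ a b → a + b + b ≡ a + 2 * b
      ar = solve-∀
    cases : (∃[ x ] (M +ᶠ D u f) x ≡ true) ⊎ (∀ x → (M +ᶠ D u f) x ≡ false) → wt (D u f) ≤ 2 * q
    cases (inj₁ (x , e)) = lin≤ 0 (+-mono-≤ (min-weight (suc s)
        (I-+ (suc s) (I-pred (suc s) M-code) (I-D s u i)) e) (≤-reflexive total))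
      (ar (wt (M +ᶠ D u f)) (wt (D u f)) q)
      where
      ar : ∀ a b q → b + (a + 4 * q) + 0 ≡ 2 * q + (2 * q + (a + b))
      ar = solve-∀
    cases (inj₂ none) = ⊥-elim (lin⊥ (1 + 2 * wt (f ∧ᶠ shift u f))
        (+-mono-≤ (*-monoʳ-≤ 2 light) (+-mono-≤ (≤-reflexive (sym total))
            (+-mono-≤ (≤-reflexive (wt-empty none)) (≤-reflexive (wt-D u)))))
      (ar w q (wt (M +ᶠ D u f)) (wt (D u f)) (wt (f ∧ᶠ shift u f))))
      where
      ar : ∀ w q m d a → 2 * suc w + (4 * q + (m + (d + 2 * a))) ≡ suc
          (2 * (2 * q) + ((m + d) + (0 + 2 * w)) + (1 + 2 * a))
      ar = solve-∀

  module Weight {p} (fp : f p ≡ true) (light : w < 2 * q) where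

    direction invariant : Fun n
    direction u = M (p ⊞ u)
    invariant u = not (some (D u f))

    common : Vec Bool n → ℕ
    common u = wt (f ∧ᶠ shift u f)

    direction-invariant : ∀ {u} → direction u ≡ true → ∀ x → M (x ⊞ u) ≡ M x
    direction-invariant {u} e x = trans (cong M (⊞-solve (x ∷ u ∷ p ∷ []) (x₀ ⊕ x₁) (x₀ ⊕ (x₂ ⊕ (x₂ ⊕ x₁))) refl))
      (flat-invariant φ (f⊆M p fp) e x)

    outside : ∀ {u} → direction u ≡ false → ∀ x → (f ∧ᶠ shift u f) x ≡ false
    outside {u} d x = ¬-not λ e → true≢false
      (on M (⊞-solve (x ∷ u ∷ p ∷ []) (x₂ ⊕ x₀ ⊕ (x₀ ⊕ x₁)) (x₂ ⊕ x₁) refl)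
        (closed φ (f⊆M p fp) (f⊆M x (∧-trueˡ e)) (f⊆M (x ⊞ u) (∧-trueʳ {f x} e)))) d

    invariant-sound : ∀ {u} → invariant u ≡ true → ∀ x → f (x ⊞ u) ≡ f x
    invariant-sound {u} e x = sym (xor-false (¬-not λ Dx → true≢false (some-intro (D u f) x Dx) (not-true e)))

    invariant-complete : ∀ {u} → (∀ x → f (x ⊞ u) ≡ f x) → invariant u ≡ true
    invariant-complete {u} e = cong not (¬-not λ s → let x , Dx = some-elim _ s in
      true≢false Dx (trans (cong (f x xor_) (e x)) (xor-same (f x))))

    invariant-flat : Flat invariant
    invariant-flat = flat λ {u} {v} {w} a b c → invariant-complete {u ⊞ v ⊞ w} λ x →
      trans (cong f (⊞-solve (x ∷ u ∷ v ∷ w ∷ []) (x₀ ⊕ (x₁ ⊕ x₂ ⊕ x₃)) (x₀ ⊕ x₁ ⊕ x₂ ⊕ x₃) refl))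
        (trans (invariant-sound c _) (trans (invariant-sound b _) (invariant-sound a x)))

    -- A table free of subtraction: `common u` is `w` if `u` fixes `f`, `w - q` for the other
    -- directions of `M`, and `0` for all remaining `u`.
    balance : ∀ u → common u + q * 𝟙 (direction u) ≡ w * 𝟙 (direction u) + q * 𝟙 (invariant u)
    balance u = cases (direction u) refl (search (D u f))
      where
      cases : ∀ d → direction u ≡ d → (∃[ x ] D u f x ≡ true) ⊎ (∀ x → D u f x ≡ false) →
        common u + q * 𝟙 (direction u) ≡ w * 𝟙 (direction u) + q * 𝟙 (invariant u)
      cases false d _ rewrite d = begin
        common u + q * 0              ≡⟨ cong (_+ q * 0) (wt-empty (outside {u} d)) ⟩
        q * 0                         ≡⟨ cong (λ b → q * 𝟙 b) not-invariant ⟨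
        q * 𝟙 (invariant u)           ≡⟨ cong (_+ q * 𝟙 (invariant u)) (*-zeroʳ w) ⟨
        w * 0 + q * 𝟙 (invariant u)   ∎
        where
        open ≡-Reasoning
        not-invariant : invariant u ≡ false
        not-invariant = ¬-not λ e → true≢false (f⊆M (p ⊞ u) (trans (invariant-sound e p) fp)) d
      cases true d (inj₁ (x , Dx)) rewrite d | some-intro (D u f) x Dx = *-cancelˡ-≡ _ _ 2
          (+-cancelˡ-≡ (wt (D u f)) _ _
        (trans (i₁ (wt (D u f)) (common u) q) (trans
            (cong₂ _+_ (wt-D u) (sym (derivative-weight light (direction-invariant {u} d) Dx)))
          (i₂ w (wt (D u f)) q))))
        where
        i₁ : ∀ d c q → d + 2 * (c + q * 1) ≡ d + 2 * c + 2 * q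
        i₁ = solve-∀
        i₂ : ∀ w d q → 2 * w + d ≡ d + 2 * (w * 1 + q * 0)
        i₂ = solve-∀
      cases true d (inj₂ none) rewrite d | invariant-complete {u} (λ x → sym (xor-false (none x))) = cong (_+ q * 1)
        (*-cancelˡ-≡ (common u) (w * 1) 2 (trans (sym (cong (_+ 2 * common u) (wt-empty none)))
            (trans (wt-D u) (cong (2 *_) (sym (*-identityʳ w))))))

    ∑-common : ∑ common ≡ w * w
    ∑-common = begin
      ∑ (λ u → ∑ (λ x → 𝟙 (f x ∧ f (x ⊞ u))))  ≡⟨ ∑-swap (λ u x → 𝟙 (f x ∧ f (x ⊞ u))) ⟩
      ∑ (λ x → ∑ (λ u → 𝟙 (f x ∧ f (x ⊞ u))))  ≡⟨ ∑-cong (λ x → slice (f x) x) ⟩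
      ∑ (λ x → w * 𝟙 (f x))                    ≡⟨ ∑-* w (𝟙 ∘ f) ⟩
      w * w                                    ∎
      where
      open ≡-Reasoning
      slice : ∀ b x → ∑ (λ u → 𝟙 (b ∧ f (x ⊞ u))) ≡ w * 𝟙 b
      slice true x = trans (∑-cong λ u → cong (𝟙 ∘ f) (⊞-comm x u)) (trans (wt-shift x f) (sym (*-identityʳ w)))
      slice false x = trans (∑-0 {n}) (sym (*-zeroʳ w))

    ρ : ℕ
    ρ = wt invariant

    total : w * w + q * (4 * q) ≡ w * (4 * q) + q * ρ
    total = begin
      w * w + q * (4 * q)
          ≡⟨ cong₂ (λ a b → a + q * b) ∑-common wt-direction ⟨
      ∑ common + q * wt direction
          ≡⟨ cong (∑ common +_) (∑-* q (𝟙 ∘ direction)) ⟨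
      ∑ common + ∑ (λ u → q * 𝟙 (direction u))                            ≡⟨ ∑-+ common _ ⟨
      ∑ (λ u → common u + q * 𝟙 (direction u))                            ≡⟨ ∑-cong balance ⟩
      ∑ (λ u → w * 𝟙 (direction u) + q * 𝟙 (invariant u))                 ≡⟨ ∑-+ (λ u → w * 𝟙 (direction u)) _ ⟩
      ∑ (λ u → w * 𝟙 (direction u)) + ∑ (λ u → q * 𝟙 (invariant u))
          ≡⟨ cong₂ _+_ (∑-* w (𝟙 ∘ direction)) (∑-* q (𝟙 ∘ invariant)) ⟩
      w * wt direction + q * ρ                                            ≡⟨ cong (λ t → w * t + q * ρ) wt-direction ⟩
      w * (4 * q) + q * ρ                                                 ∎
      where
      open ≡-Reasoning
      wt-direction : wt direction ≡ 4 * q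
      wt-direction = trans (wt-cong λ u → cong M (⊞-comm p u)) (trans (wt-shift p M) wM)

    weight : ∃[ e ] w + 2 ^ e ≡ 2 * q
    weight with δ , w+δ ← m≤n⇒∃[o]m+o≡n (<⇒≤ light) =
      let e , ρ≡ = flat-wt invariant-flat (invariant-complete {𝟎} (λ x → cong f (⊞-idʳ x)))
          e′ , δ≡ = square-power (s + e) (trans (square δ w+δ) (trans (cong (q *_) ρ≡) (sym (^-distribˡ-+-* 2 s e))))
      in e′ , trans (cong (w +_) (sym δ≡)) w+δ
      where
      square : ∀ δ → w + δ ≡ 2 * q → δ * δ ≡ q * ρ
      square δ e = +-cancelˡ-≡ (w * w + w * w + 2 * (w * δ)) _ _ (begin
        w * w + w * w + 2 * (w * δ) + δ * δ      ≡⟨ i₁ w δ ⟩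
        w * w + (w + δ) * (w + δ)                ≡⟨ cong (λ t → w * w + t * t) e ⟩
        w * w + 2 * q * (2 * q)                  ≡⟨ i₂ w q ⟩
        w * w + q * (4 * q)                      ≡⟨ total ⟩
        w * (4 * q) + q * ρ                      ≡⟨ i₃ w q (q * ρ) ⟩
        2 * (w * (2 * q)) + q * ρ                ≡⟨ cong (λ t → 2 * (w * t) + q * ρ) e ⟨
        2 * (w * (w + δ)) + q * ρ                ≡⟨ i₄ w δ (q * ρ) ⟩
        w * w + w * w + 2 * (w * δ) + q * ρ      ∎)
        where
        open ≡-Reasoning
        i₁ : ∀ w δ → w * w + w * w + 2 * (w * δ) + δ * δ ≡ w * w + (w + δ) * (w + δ)
        i₁ = solve-∀
        i₂ : ∀ w q → w * w + 2 * q * (2 * q) ≡ w * w + q * (4 * q)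
        i₂ = solve-∀
        i₃ : ∀ w q r → w * (4 * q) + r ≡ 2 * (w * (2 * q)) + r
        i₃ = solve-∀
        i₄ : ∀ w δ r → 2 * (w * (w + δ)) + r ≡ w * w + w * w + 2 * (w * δ) + r
        i₄ = solve-∀

  -- Third derivatives of f along M vanish, so f is quadratic there; hence so is its complement in K.
  module Section {K : Fun n} (κ : Flat K) (K⊆M : ∀ x → K x ≡ true → M x ≡ true) where

    M-invariant : ∀ {a b} → K a ≡ true → K b ≡ true → ∀ x → M (x ⊞ (a ⊞ b)) ≡ M x
    M-invariant {a} {b} Ka Kb = flat-invariant φ (K⊆M a Ka) (K⊆M b Kb)

    -- A third derivative is a word of minimum distance `8 * q` supported on the `4 * q` points of
    -- `M`.
    third : ∀ {u v t} → (∀ x → M (x ⊞ u) ≡ M x) → (∀ x → M (x ⊞ v) ≡ M x) → (∀ x → M (x ⊞ t) ≡ M x) →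
      ∀ x → D t (D v (D u f)) x ≡ false
    third {u} {v} {t} iu iv it = light-empty (3 + s) (I-D (2 + s) t (I-D (1 + s) v (I-D s u i)))
      (≤-<-trans (wt-mono {g = M} (D-⊆ (D-⊆ (D-⊆ f⊆M iu) iv) it)) M<8q)
      where
      ar : ∀ W q → suc W + (4 * q + q) + 3 * q ≡ 2 * (2 * (2 * q)) + (W + 1)
      ar = solve-∀
      M<8q : wt M < 2 ^ (3 + s)
      M<8q = lin≤ (3 * q) (+-mono-≤ (≤-reflexive wM) (m^n>0 2 s)) (ar (wt M) q)

    halving : ∀ g {a b} → K a ≡ true → K b ≡ true → wt (K ∧ᶠ D (a ⊞ b) g) ≤ 2 * wt (K ∧ᶠ g)
    halving g {a} {b} Ka Kb = begin
      wt (K ∧ᶠ D u g)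
          ≤⟨ ∑-mono (λ x → pt (K x) (K (x ⊞ u)) (g x) (g (x ⊞ u)) (flat-invariant κ Ka Kb x)) ⟩
      ∑ (λ x → 𝟙 (K x ∧ g x) + 𝟙 (K (x ⊞ u) ∧ g (x ⊞ u)))   ≡⟨ ∑-+ (𝟙 ∘ (K ∧ᶠ g)) _ ⟩
      wt (K ∧ᶠ g) + wt (shift u (K ∧ᶠ g))                   ≡⟨ cong (wt (K ∧ᶠ g) +_) (wt-shift u (K ∧ᶠ g)) ⟩
      wt (K ∧ᶠ g) + wt (K ∧ᶠ g)                             ≡⟨ cong (wt (K ∧ᶠ g) +_) (+-identityʳ _) ⟨
      2 * wt (K ∧ᶠ g)                                       ∎
      where
      open ≤-Reasoning
      u = a ⊞ b
      pt : ∀ k k′ a b → k′ ≡ k → 𝟙 (k ∧ (a xor b)) ≤ 𝟙 (k ∧ a) + 𝟙 (k′ ∧ b)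
      pt false .false a b refl = z≤n
      pt true .true true true refl = z≤n
      pt true .true true false refl = ≤-refl
      pt true .true false b refl = ≤-refl

    D-not : ∀ u → D u (¬ᶠ f) ≗ D u f
    D-not u x = pt (f x) (f (x ⊞ u))
      where
      pt : ∀ a b → not a xor not b ≡ a xor b
      pt true true = refl
      pt true false = refl
      pt false true = refl
      pt false false = refl

    wt-K≤ : ∀ g c → wt (K ∧ᶠ g) ≤ c → (∀ x → (K ∧ᶠ ¬ᶠ g) x ≡ false) → wt K ≤ c
    wt-K≤ g c le none = ≤-trans (wt-mono λ x Kx → ∧-true Kx
        (¬-not λ gx → true≢false (∧-true Kx (cong not gx)) (none x))) le

    -- The minimum distance of quadratic polynomials, for the complement of `f`. While the current
    -- function is not constantly true on `K`, it is differentiated along the difference of `p` and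
    -- a point where it is false; the derivative is true at `p` and has at most twice the weight.
    -- After two derivatives the function is constant by `third`.
    quadratic-section : ∀ {p} → K p ≡ true → f p ≡ false → wt K ≤ 4 * wt (K ∧ᶠ ¬ᶠ f)
    quadratic-section {p} Kp fp = first (search (K ∧ᶠ ¬ᶠ (¬ᶠ f)))
      where
      G : ℕ
      G = wt (K ∧ᶠ ¬ᶠ f)
      second : ∀ {a} → K a ≡ true → f a ≡ true →
        (∃[ x ] (K ∧ᶠ ¬ᶠ (D (p ⊞ a) f)) x ≡ true) ⊎ (∀ x → (K ∧ᶠ ¬ᶠ (D (p ⊞ a) f)) x ≡ false) → wt K ≤ 4 * G
      second {a} Ka fa = third-step (≤-trans (≤-reflexive (wt-cong λ x → cong (K x ∧_) (sym (D-not u x))))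
          (halving (¬ᶠ f) Kp Ka))
        where
        u : Vec Bool n
        u = p ⊞ a
        g₁ : Fun n
        g₁ = D u f
        g₁p : g₁ p ≡ true
        g₁p = cong₂ _xor_ fp (trans (cong f (⊞-cancelˡ p a)) fa)
        third-step : wt (K ∧ᶠ g₁) ≤ 2 * G → (∃[ x ] (K ∧ᶠ ¬ᶠ g₁) x ≡ true) ⊎ (∀ x → (K ∧ᶠ ¬ᶠ g₁) x ≡ false) →
            wt K ≤ 4 * G
        third-step bound (inj₂ none) = wt-K≤ g₁ (4 * G) (≤-trans bound (*-monoˡ-≤ G {2} {4} (s≤s (s≤s z≤n)))) none
        third-step bound (inj₁ (b , e)) = begin
          wt K                      ≤⟨ wt-mono (λ x Kx → ∧-true Kx (g₂-constant x Kx)) ⟩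
          wt (K ∧ᶠ g₂)              ≤⟨ halving g₁ Kp Kb ⟩
          2 * wt (K ∧ᶠ g₁)          ≤⟨ *-monoʳ-≤ 2 bound ⟩
          2 * (2 * G)               ≡⟨ *-assoc 2 2 G ⟨
          4 * G                     ∎
          where
          open ≤-Reasoning
          Kb : K b ≡ true
          Kb = ∧-trueˡ e
          g₂ : Fun n
          g₂ = D (p ⊞ b) g₁
          g₂p : g₂ p ≡ true
          g₂p = cong₂ _xor_ g₁p (trans (cong g₁ (⊞-cancelˡ p b)) (not-true (∧-trueʳ {K b} e)))
          g₂-constant : ∀ x → K x ≡ true → g₂ x ≡ true
          g₂-constant x Kx = trans (cong g₂ (sym (⊞-cancelˡ p x)))
            (trans (sym (xor-false (third (M-invariant Kp Ka) (M-invariant Kp Kb) (M-invariant Kp Kx) p))) g₂p)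
      first : (∃[ x ] (K ∧ᶠ ¬ᶠ (¬ᶠ f)) x ≡ true) ⊎ (∀ x → (K ∧ᶠ ¬ᶠ (¬ᶠ f)) x ≡ false) → wt K ≤ 4 * G
      first (inj₂ none) = wt-K≤ (¬ᶠ f) (4 * G) (m≤m+n G _) none
      first (inj₁ (a , e)) = second {a} (∧-trueˡ e) (trans (sym (not-involutive (f a))) (∧-trueʳ {K a} e)) (search _)

-- With `δ` for `2 * q - wt g`, lightness gives `q < 2 * b + δ`, and `4 * δ ≤ q`, so `K` has more
-- than three eighths of `q` points: its size is `q` or `q / 2`. If it is `q`, then `L` lies in `M`.
-- If it is `q / 2`, then `G` is positive because adding `L` increases the weight, yet less than a
-- quarter of `K`, against `quadratic-section`.
quadric-step : ∀ {n} s {g L M : Fun n} {p} → I s g → g p ≡ true → Flat M → wt M ≡ 4 * 2 ^ s →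
    (∀ x → g x ≡ true → M x ≡ true) →
  3 * 2 ^ s < 2 * wt g → IsFlat s L → wt g < wt (g +ᶠ L) → wt (g +ᶠ L) < 2 * 2 ^ s → Shape s (g +ᶠ L)
quadric-step {n} s {g} {L} {M} {p} i gp φ wM g⊆M heavy (λL , wL) g< light = cases (m≤n⇒m<n∨m≡n K≤q)
  where
  q b G : ℕ
  q = 2 ^ s
  b = wt (g ∧ᶠ L)
  K : Fun n
  K = L ∧ᶠ M
  G = wt (K ∧ᶠ ¬ᶠ g)

  weight : wt (g +ᶠ L) + 2 * b ≡ wt g + q
  weight = trans (wt-+ g L) (cong (wt g +_) wL)

  gap : ∃[ e ] wt g + 2 ^ e ≡ 2 * q
  gap = OnFlat.Weight.weight s i φ wM g⊆M gp (<-trans g< light)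
  δ : ℕ
  δ = 2 ^ proj₁ gap
  g+δ : wt g + δ ≡ 2 * q
  g+δ = proj₂ gap

  -- The lower bound on the weight carried by `quadric` gives `2 * δ < q`, and both sides are powers
  -- of two.
  4δ≤q : 4 * δ ≤ q
  4δ≤q = ≤-trans (≤-reflexive (*-assoc 2 2 δ)) (power-< (suc (proj₁ gap) , refl) (s , refl)
    (lin≤ 0 (+-mono-≤ heavy (*-monoʳ-≤ 2 (≤-reflexive g+δ))) (ar (wt g) q δ)))
    where
    ar : ∀ w q δ → suc (2 * δ) + (2 * w + 2 * (2 * q)) + 0 ≡ q + (suc (3 * q) + 2 * (w + δ))
    ar = solve-∀

  q<2b+δ : q < 2 * b + δ
  q<2b+δ = lin≤ 0 (+-mono-≤ light (+-mono-≤ (≤-reflexive (sym weight)) (≤-reflexive (sym g+δ))))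
      (ar (wt (g +ᶠ L)) (wt g) q b δ)
    where
    ar : ∀ W w q b δ → suc q + (2 * q + ((W + 2 * b) + (w + δ))) + 0 ≡ 2 * b + δ + (suc W + ((w + q) + 2 * q))
    ar = solve-∀

  2b<q : 2 * b < q
  2b<q = lin≤ 0 (+-mono-≤ g< (≤-reflexive weight)) (ar (wt (g +ᶠ L)) (wt g) q b)
    where
    ar : ∀ W w q b → suc (2 * b) + (W + (w + q)) + 0 ≡ q + (suc w + (W + 2 * b))
    ar = solve-∀

  K-meets-g : wt (K ∧ᶠ g) ≡ b
  K-meets-g = wt-cong λ x → bool-ext (λ e → ∧-true (∧-trueʳ {K x} e) (∧-trueˡ (∧-trueˡ e)))
    (λ e → ∧-true (∧-true (∧-trueʳ {g x} e) (g⊆M x (∧-trueˡ e))) (∧-trueˡ e))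

  b+G : b + G ≡ wt K
  b+G = trans (cong (_+ G) (sym K-meets-g)) (wt-split K g)

  K≤q : wt K ≤ q
  K≤q = ≤-trans (wt-mono {f = K} {L} λ x → ∧-trueˡ) (≤-reflexive wL)

  K-flat : Flat K
  K-flat = flat-∧ λL φ

  K-power : IsPower (wt K)
  K-power = flat-wt K-flat (proj₂ (wt-pos {f = K} (*-cancelˡ-< 8 0 (wt K)
    (lin≤ (3 + 3 * q + 8 * G) (+-mono-≤ (*-monoʳ-≤ 4 q<2b+δ) (+-mono-≤ 4δ≤q (≤-reflexive (cong (8 *_) b+G))))
        (ar q b δ G (wt K))))))
    where
    ar : ∀ q b δ G K → suc (8 * 0) + (4 * (2 * b + δ) + (q + 8 * K)) + (3 + 3 * q + 8 * G) ≡ 8 * K +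
        (4 * suc q + (4 * δ + 8 * (b + G)))
    ar = solve-∀

  half : wt K < q → 2 * wt K ≡ q
  half lt = ≤-antisym (power-< K-power (s , refl) lt) (≮⇒≥ λ 2K<q →
    lin⊥ (3 + q + 8 * G) (+-mono-≤ (*-monoʳ-≤ 4 q<2b+δ) (+-mono-≤ (+-mono-≤ 4δ≤q (≤-reflexive (cong (8 *_) b+G)))
      (*-monoʳ-≤ 2 (power-< (power-2* K-power) (s , refl) 2K<q)))) (ar q b δ G (wt K)))
    where
    ar : ∀ q b δ G K → 4 * suc q + (4 * δ + 8 * (b + G) + 2 * (2 * (2 * K))) ≡ suc
        (4 * (2 * b + δ) + (q + 8 * K + 2 * q) + (3 + q + 8 * G))
    ar = solve-∀

  G-pos : 2 * wt K ≡ q → 0 < G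
  G-pos e = *-cancelˡ-< 2 0 G (lin≤ 0 (+-mono-≤ 2b<q
      (+-mono-≤ (≤-reflexive (sym e)) (≤-reflexive (cong (2 *_) (sym b+G))))) (ar q b G (wt K)))
    where
    ar : ∀ q b G K → suc (2 * 0) + (q + (2 * K + 2 * (b + G))) + 0 ≡ 2 * G + (suc (2 * b) + (q + 2 * K))
    ar = solve-∀

  4G<K : 2 * wt K ≡ q → 4 * G < wt K
  4G<K e = *-cancelˡ-< 2 (4 * G) (wt K) (lin≤ 3 (+-mono-≤ (*-monoʳ-≤ 4 q<2b+δ)
      (+-mono-≤ (+-mono-≤ 4δ≤q (≤-reflexive (cong (8 *_) b+G)))
      (+-mono-≤ (*-monoʳ-≤ 4 (≤-reflexive e)) (≤-reflexive (sym e))))) (ar q b δ G (wt K)))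
    where
    ar : ∀ q b δ G K → suc (2 * (4 * G)) + (4 * (2 * b + δ) + (q + 8 * K + (4 * q + 2 * K))) + 3 ≡ 2 * K +
        (4 * suc q + (4 * δ + 8 * (b + G) + (4 * (2 * K) + q)))
    ar = solve-∀

  cases : wt K < q ⊎ wt K ≡ q → Shape s (g +ᶠ L)
  cases (inj₂ K≡q) = quadric φ wM support (<-trans heavy (*-monoʳ-< 2 g<))
    where
    support : ∀ x → (g +ᶠ L) x ≡ true → M x ≡ true
    support x e with g x in gx
    ... | true = g⊆M x gx
    ... | false = ∧-trueʳ {L x} (wt-⊆-≥ {f = K} {L} (λ y → ∧-trueˡ) (≤-reflexive (trans wL (sym K≡q))) x e)
  cases (inj₁ K<q) = contradictory (half K<q)
    where
    contradictory : 2 * wt K ≡ q → Shape s (g +ᶠ L)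
    contradictory 2K≡q = let x , e = wt-pos {f = K ∧ᶠ ¬ᶠ g} (G-pos 2K≡q) in
      ⊥-elim (<⇒≱ (4G<K 2K≡q)
        (OnFlat.Section.quadratic-section s i φ wM g⊆M K-flat (λ y → ∧-trueʳ {L y}) (∧-trueˡ e)
            (not-true (∧-trueʳ {K x} e))))

-- The argument `k` bounds the weight and carries the induction. That `g` is lighter than `f` serves
-- twice: it permits the recursive call, and `quadric-step` uses it again when `L` is added back.
shape : ∀ k {n} s {f : Fun n} {p} → I s f → f p ≡ true → wt f < 2 * 2 ^ s → wt f < k → Shape s f
shape (suc k) {n} s {f} {p} i fp light (s≤s f≤k) = step (majority-flat s i fp light)
  where
  step : ∃[ L ] (Flat L × wt L ≡ 2 ^ s × 2 ^ s < 2 * wt (f ∧ᶠ L)) → Shape s f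
  step (L , λL , wL , maj) = peel (search g)
    where
    flL : IsFlat s L
    flL = λL , wL
    g : Fun n
    g = f +ᶠ L
    g-code : I s g
    g-code = I-+ s i (proj₁ (flat-small s flL))
    g< : wt g < wt f
    g< = lin≤ 0 (+-mono-≤ maj (≤-reflexive (trans (wt-+ f L) (cong (wt f +_) wL))))
        (ar (wt g) (wt (f ∧ᶠ L)) (wt f) (2 ^ s))
      where
      ar : ∀ W c w q → suc W + (2 * c + (w + q)) + 0 ≡ w + (suc q + (W + 2 * c))
      ar = solve-∀
    restore : ∀ a b → a ≡ (a xor b) xor b
    restore a b = sym (trans (xor-assoc a b b) (trans (cong (a xor_) (xor-same b)) (xor-identityʳ a)))
    f≗g+L : f ≗ (g +ᶠ L)
    f≗g+L x = restore (f x) (L x)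
    back : Shape s (g +ᶠ L) → Shape s f
    back = shape-cong (λ x → sym (f≗g+L x))
    add : Shape s g → ∀ {x} → g x ≡ true → Shape s f
    add (quadric φ wM g⊆M heavy) gx = back (quadric-step s g-code gx φ wM g⊆M heavy flL
        (<-≤-trans g< (≤-reflexive (wt-cong f≗g+L)))
      (≤-<-trans (≤-reflexive (sym (wt-cong f≗g+L))) light))
    add (two-flats {X} {Y} sX sY e) _ = sum (small-cases s sX) (small-cases s sY)
      where
      f≗ : f ≗ (X +ᶠ Y +ᶠ L)
      f≗ x = trans (f≗g+L x) (cong (_xor L x) (e x))
      sum : (∀ x → X x ≡ false) ⊎ IsFlat s X → (∀ x → Y x ≡ false) ⊎ IsFlat s Y → Shape s f
      sum (inj₁ none) _ = two-flats sY (flat-small s flL)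
          (λ x → trans (f≗ x) (cong (λ b → (b xor Y x) xor L x) (none x)))
      sum (inj₂ _) (inj₁ none) = two-flats sX (flat-small s flL)
        (λ x → trans (f≗ x) (cong (_xor L x) (trans (cong (X x xor_) (none x)) (xor-identityʳ (X x)))))
      sum (inj₂ flX) (inj₂ flY) = shape-cong (λ x → sym (f≗ x))
        (three-flats s flX flY flL (≤-<-trans (≤-reflexive (sym (wt-cong f≗))) light))
    peel : (∃[ x ] g x ≡ true) ⊎ (∀ x → g x ≡ false) → Shape s f
    peel (inj₂ none) = two-flats (flat-small s flL)
        (I-0 s (λ _ → refl) , ≤-trans (≤-reflexive (wt-empty {n} (λ _ → refl))) z≤n)
      (λ x → trans (xor-false (none x)) (sym (xor-identityʳ (L x))))
    peel (inj₁ (x , gx)) = add (shape k s g-code gx (<-trans g< light) (<-≤-trans g< f≤k)) gx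

-- A weak form of the Kasami–Tokura theorem on the weights of Reed–Muller codes
weight-gap : ∀ {n} s {f : Fun n} {p} → I s f → f p ≡ true → wt f < 2 * 2 ^ s → ∃[ e ] wt f + 2 ^ e ≡ 2 * 2 ^ s
weight-gap s {f} {p} i fp light = by-shape (shape (suc (wt f)) s i fp light ≤-refl)
  where
  by-shape : Shape s f → ∃[ e ] wt f + 2 ^ e ≡ 2 * 2 ^ s
  by-shape (quadric φ wM f⊆M _) = OnFlat.Weight.weight s i φ wM f⊆M fp light
  by-shape (two-flats {X} {Y} sX sY f≗) = sum (small-cases s sX) (small-cases s sY)
    where
    one-flat : ∀ {Z} → IsFlat s Z → f ≗ Z → ∃[ e ] wt f + 2 ^ e ≡ 2 * 2 ^ s
    one-flat (_ , w) e = s , cong₂ _+_ (trans (wt-cong e) w) (sym (+-identityʳ (2 ^ s)))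
    sum : (∀ x → X x ≡ false) ⊎ IsFlat s X → (∀ x → Y x ≡ false) ⊎ IsFlat s Y → ∃[ e ] wt f + 2 ^ e ≡ 2 * 2 ^ s
    sum (inj₁ noneX) (inj₁ noneY) = ⊥-elim (true≢false fp (trans (f≗ p) (cong₂ _xor_ (noneX p) (noneY p))))
    sum (inj₁ none) (inj₂ flY) = one-flat flY (λ x → trans (f≗ x) (cong (_xor Y x) (none x)))
    sum (inj₂ flX) (inj₁ none) = one-flat flX (λ x → trans (f≗ x)
        (trans (cong (X x xor_) (none x)) (xor-identityʳ (X x))))
    sum (inj₂ flX) (inj₂ flY) = meeting (flats-meet s flX flY)
      where
      weight : wt f + 2 * wt (X ∧ᶠ Y) ≡ 2 * 2 ^ s
      weight = trans (cong (_+ 2 * wt (X ∧ᶠ Y)) (wt-cong f≗)) (trans (wt-+ X Y)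
        (cong₂ _+_ (proj₂ flX) (trans (proj₂ flY) (sym (+-identityʳ (2 ^ s))))))
      meeting : wt (X ∧ᶠ Y) ≡ 0 ⊎ IsPower (wt (X ∧ᶠ Y)) → ∃[ e ] wt f + 2 ^ e ≡ 2 * 2 ^ s
      meeting (inj₁ z) = ⊥-elim (<-irrefl (trans (sym (+-identityʳ (wt f)))
          (trans (cong (λ c → wt f + 2 * c) (sym z)) weight)) light)
      meeting (inj₂ (e , c)) = suc e , trans (cong (λ c → wt f + 2 * c) (sym c)) weight

-- Codes from trades

-- As a function of its second argument this is the monomial in the variables of `A`.
contains : ∀ {v} → Vec Bool v → Fun v
contains [] [] = true
contains (true ∷ A) (b ∷ B) = b ∧ contains A B
contains (false ∷ A) (b ∷ B) = contains A B

⊆?-contains : ∀ {v} (A B : Subset v) → does (A ⊆? B) ≡ contains A B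
⊆?-contains [] [] = refl
⊆?-contains (true ∷ A) (true ∷ B) = ⊆?-contains A B
⊆?-contains (true ∷ A) (false ∷ B) = refl
⊆?-contains (false ∷ A) (b ∷ B) = ⊆?-contains A B

degree-∷ : ∀ {v} (A B : Subset v) C → degree A (B ∷ C) ≡ 𝟙 (contains A B) + degree A C
degree-∷ A B C rewrite sym (⊆?-contains A B) with does (A ⊆? B)
... | true = refl
... | false = refl

degree-++ : ∀ {v} (A : Subset v) C C′ → degree A (C ++ C′) ≡ degree A C + degree A C′
degree-++ A [] C′ = refl
degree-++ A (B ∷ C) C′ = trans (degree-∷ A B (C ++ C′)) (trans (cong (𝟙 (contains A B) +_) (degree-++ A C C′))
  (trans (sym (+-assoc (𝟙 (contains A B)) _ _)) (cong (_+ degree A C′) (sym (degree-∷ A B C)))))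

contains-𝟎 : ∀ {v} (B : Subset v) → contains 𝟎 B ≡ true
contains-𝟎 [] = refl
contains-𝟎 (b ∷ B) = contains-𝟎 B

∣𝟎∣ : ∀ v → ∣ 𝟎 {v} ∣ ≡ 0
∣𝟎∣ zero = refl
∣𝟎∣ (suc v) = ∣𝟎∣ v

degree-𝟎 : ∀ {v} (C : Collection v) → degree 𝟎 C ≡ length C
degree-𝟎 [] = refl
degree-𝟎 (B ∷ C) = trans (degree-∷ 𝟎 B C) (cong₂ (λ b m → 𝟙 b + m) (contains-𝟎 B) (degree-𝟎 C))

contains-insert : ∀ {v} (A : Subset v) i B → contains A B ∧ lookup B i ≡ contains (A [ i ]≔ true) B
contains-insert (true ∷ A) zero (true ∷ B) = ∧-identityʳ _
contains-insert (true ∷ A) zero (false ∷ B) = refl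
contains-insert (false ∷ A) zero (b ∷ B) = ∧-comm _ b
contains-insert (true ∷ A) (suc i) (b ∷ B) = trans (∧-assoc b _ _) (cong (b ∧_) (contains-insert A i B))
contains-insert (false ∷ A) (suc i) (b ∷ B) = contains-insert A i B

∣insert∣ : ∀ {v} (A : Subset v) i → ∣ A [ i ]≔ true ∣ ≤ suc ∣ A ∣
∣insert∣ (true ∷ A) zero = n≤1+n _
∣insert∣ (false ∷ A) zero = ≤-refl
∣insert∣ (true ∷ A) (suc i) = s≤s (∣insert∣ A i)
∣insert∣ (false ∷ A) (suc i) = ∣insert∣ A i

affine-∷ : ∀ {n} {h : Fun (suc n)} → Affine h → ∀ x → h (true ∷ x) ≡ h (false ∷ x) xor
    (h (true ∷ 𝟎) xor h (false ∷ 𝟎))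
affine-∷ {h = h} ah x = trans (cong (λ y → h (true ∷ y)) (sym (trans (⊞-idʳ (x ⊞ 𝟎)) (⊞-idʳ x))))
  (at-sum ah (false ∷ x) (true ∷ 𝟎) (false ∷ 𝟎))

-- An affine function is a combination of the constant one and the coordinates. Here `κ` is the
-- coefficient of the first coordinate; the rest depends on the tail only and pairs with `g₀ +ᶠ g₁`,
-- the projection of `g` along that coordinate.
affine-orthogonal : ∀ {n} (g : Fun n) {h} → par g ≡ false → (∀ i → par (g ∧ᶠ (λ x → lookup x i)) ≡ false) →
  Affine h → par (g ∧ᶠ h) ≡ false
affine-orthogonal {zero} g {h} even _ _ with g []
... | false = refl
affine-orthogonal {suc n} g {h} even even-i ah = begin
  par (g ∧ᶠ h)                                        ≡⟨ odd-+ (wt (g₀ ∧ᶠ h₀)) _ ⟩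
  par (g₀ ∧ᶠ h₀) xor par (g₁ ∧ᶠ (h ∘ (true ∷_)))
      ≡⟨ cong (par (g₀ ∧ᶠ h₀) xor_) (trans (par-cong λ x → trans (cong (g₁ x ∧_) (affine-∷ ah x))
          (pt (g₁ x) (h₀ x) κ)) (par-+ (g₁ ∧ᶠ h₀) _)) ⟩
  par (g₀ ∧ᶠ h₀) xor (par (g₁ ∧ᶠ h₀) xor par (λ x → κ ∧ g₁ x))
      ≡⟨ cong (λ b → par (g₀ ∧ᶠ h₀) xor (par (g₁ ∧ᶠ h₀) xor b)) (scaled κ) ⟩
  par (g₀ ∧ᶠ h₀) xor (par (g₁ ∧ᶠ h₀) xor false)       ≡⟨ cong (par (g₀ ∧ᶠ h₀) xor_) (xor-identityʳ _) ⟩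
  par (g₀ ∧ᶠ h₀) xor par (g₁ ∧ᶠ h₀)                   ≡⟨ folded h₀ ⟨
  par ((g₀ +ᶠ g₁) ∧ᶠ h₀)
      ≡⟨ affine-orthogonal (g₀ +ᶠ g₁) sum-even sum-even-i
          (affine λ x y z → at-sum ah (false ∷ x) (false ∷ y) (false ∷ z)) ⟩
  false                                               ∎
  where
  open ≡-Reasoning
  g₀ g₁ h₀ : Fun n
  g₀ = g ∘ (false ∷_)
  g₁ = g ∘ (true ∷_)
  h₀ = h ∘ (false ∷_)
  κ : Bool
  κ = h (true ∷ 𝟎) xor h (false ∷ 𝟎)
  pt : ∀ a b k → a ∧ (b xor k) ≡ (a ∧ b) xor (k ∧ a)
  pt true b k = cong (b xor_) (sym (∧-identityʳ k))
  pt false b k = sym (∧-zeroʳ k)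
  folded : ∀ h → par ((g₀ +ᶠ g₁) ∧ᶠ h) ≡ par (g₀ ∧ᶠ h) xor par (g₁ ∧ᶠ h)
  folded h = trans (par-cong λ x → ∧-distribʳ-xor (h x) (g₀ x) (g₁ x)) (par-+ (g₀ ∧ᶠ h) (g₁ ∧ᶠ h))
  g₁-even : par g₁ ≡ false
  g₁-even = trans (cong odd (sym (cong₂ _+_ (wt-empty {f = λ x → g₀ x ∧ false} (λ x → ∧-zeroʳ (g₀ x)))
      (wt-cong λ x → ∧-identityʳ (g₁ x))))) (even-i zero)
  scaled : ∀ k → par (λ x → k ∧ g₁ x) ≡ false
  scaled true = g₁-even
  scaled false = cong odd (wt-empty {n} (λ _ → refl))
  sum-even : par (g₀ +ᶠ g₁) ≡ false
  sum-even = trans (par-+ g₀ g₁) (trans (sym (odd-+ (wt g₀) (wt g₁))) even)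
  sum-even-i : ∀ i → par ((g₀ +ᶠ g₁) ∧ᶠ (λ x → lookup x i)) ≡ false
  sum-even-i i = trans (folded (λ x → lookup x i)) (trans (sym (odd-+ (wt (g₀ ∧ᶠ λ x → lookup x i)) _))
      (even-i (suc i)))

-- Monomials of degree below `s` suffice: `affine-orthogonal` replaces an affine factor by
-- coordinates, and multiplying a monomial by a coordinate raises its degree by at most one, since
-- variables are idempotent.
I-contains : ∀ {n} s {f : Fun n} → (∀ A → ∣ A ∣ < s → par (f ∧ᶠ contains A) ≡ false) → I s f
I-contains zero _ = tt
I-contains {n} (suc s) {f} even = 
  trans (par-cong λ x → sym (trans (cong (f x ∧_) (contains-𝟎 x)) (∧-identityʳ (f x))))
      (even 𝟎 (subst (_< suc s) (sym (∣𝟎∣ n)) (s≤s z≤n))) ,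
  λ h ah → I-contains s λ A A<s → trans (par-cong λ x → swap (f x) (h x) _)
    (affine-orthogonal (f ∧ᶠ contains A) (even A (m<n⇒m<1+n A<s))
      (λ i → trans (par-cong λ x → trans (∧-assoc (f x) _ _) (cong (f x ∧_) (contains-insert A i x)))
        (even (A [ i ]≔ true) (≤-<-trans (∣insert∣ A i) (s≤s A<s)))) ah)
  where
  swap : ∀ a b c → (a ∧ b) ∧ c ≡ (a ∧ c) ∧ b
  swap a b c = trans (∧-assoc a b c) (trans (cong (a ∧_) (∧-comm b c)) (sym (∧-assoc a c b)))

-- The incidence vector over 𝔽₂. Equal blocks cancel in pairs, which is why `wt-word` asks for a
-- list without repetitions.
word : ∀ {v} → Collection v → Fun v
word [] x = false
word (B ∷ C) = (_≡ᵛ B) +ᶠ word C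

par-word : ∀ {v} (C : Collection v) A → par (word C ∧ᶠ contains A) ≡ odd (degree A C)
par-word {v} [] A = cong odd (wt-empty {v} (λ _ → refl))
par-word (B ∷ C) A = begin
  par (((_≡ᵛ B) +ᶠ word C) ∧ᶠ contains A)
      ≡⟨ par-cong (λ x → ∧-distribʳ-xor (contains A x) (x ≡ᵛ B) (word C x)) ⟩
  par (((_≡ᵛ B) ∧ᶠ contains A) +ᶠ (word C ∧ᶠ contains A))           ≡⟨ par-+ ((_≡ᵛ B) ∧ᶠ contains A) _ ⟩
  par ((_≡ᵛ B) ∧ᶠ contains A) xor par (word C ∧ᶠ contains A)
      ≡⟨ cong₂ _xor_ (par-≡ᵛ B (contains A)) (par-word C A) ⟩
  contains A B xor odd (degree A C)
      ≡⟨ cong (_xor odd (degree A C)) (odd-𝟙 (contains A B)) ⟨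
  odd (𝟙 (contains A B)) xor odd (degree A C)                       ≡⟨ odd-+ (𝟙 (contains A B)) _ ⟨
  odd (𝟙 (contains A B) + degree A C)                               ≡⟨ cong odd (degree-∷ A B C) ⟨
  odd (degree A (B ∷ C))                                            ∎
  where
  open ≡-Reasoning
  odd-𝟙 : ∀ b → odd (𝟙 b) ≡ b
  odd-𝟙 true = refl
  odd-𝟙 false = refl

word-∉ : ∀ {v} {B : Subset v} {C} → List.All (B ≢_) C → word C B ≡ false
word-∉ [] = refl
word-∉ {B = B} {B′ ∷ C} (B≢ ∷ rest) = cong₂ _xor_ (dec-false (≡-dec _≟ᵇ_ B B′) B≢) (word-∉ rest)

wt-word : ∀ {v} {C : Collection v} → Unique C → wt (word C) ≡ length C
wt-word {v} [] = wt-empty {v} (λ _ → refl)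
wt-word {C = B ∷ C} (B∉C ∷ unique) = begin
  wt ((_≡ᵛ B) +ᶠ word C)                                       ≡⟨ +-identityʳ _ ⟨
  wt ((_≡ᵛ B) +ᶠ word C) + 2 * 0
      ≡⟨ cong (λ m → wt ((_≡ᵛ B) +ᶠ word C) + 2 * m) (wt-empty disjoint) ⟨
  wt ((_≡ᵛ B) +ᶠ word C) + 2 * wt ((_≡ᵛ B) ∧ᶠ word C)          ≡⟨ wt-+ (_≡ᵛ B) (word C) ⟩
  wt (_≡ᵛ B) + wt (word C)                                     ≡⟨ cong₂ _+_ (wt-≡ᵛ B) (wt-word unique) ⟩
  suc (length C)                                               ∎
  where
  open ≡-Reasoning
  disjoint : ∀ x → ((_≡ᵛ B) ∧ᶠ word C) x ≡ false
  disjoint x = ¬-not λ e → true≢false (trans (cong (word C) (sym (≡ᵛ-sound x B (∧-trueˡ e))))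
      (∧-trueʳ {x ≡ᵛ B} e)) (word-∉ B∉C)

-- Distinctness of the blocks, and balance on smaller subsets

sub-of-size : ∀ {v} t (B : Subset v) → t ≤ ∣ B ∣ → ∃[ A ] (∣ A ∣ ≡ t × contains A B ≡ true)
sub-of-size {v} zero B _ = 𝟎 , ∣𝟎∣ v , contains-𝟎 B
sub-of-size (suc t) (true ∷ B) (s≤s t≤) with A , a , c ← sub-of-size t B t≤ = true ∷ A , cong suc a , c
sub-of-size (suc t) (false ∷ B) t≤ with A , a , c ← sub-of-size (suc t) B t≤ = false ∷ A , a , c

degree-∈ : ∀ {v} {A B : Subset v} {C} → contains A B ≡ true → B ∈ C → 1 ≤ degree A C
degree-∈ {A = A} {B} {_ ∷ C} c (here refl) = ≤-trans (subst (λ b → 1 ≤ 𝟙 b + degree A C) (sym c) (s≤s z≤n))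
    (≤-reflexive (sym (degree-∷ A B C)))
degree-∈ {A = A} {B} {B′ ∷ C} c (there p) = ≤-trans (degree-∈ c p)
    (≤-trans (m≤n+m _ (𝟙 (contains A B′))) (≤-reflexive (sym (degree-∷ A B′ C))))

-- A repeated block would give each of its subsets of size `t` degree at least two, and such a
-- subset exists as `t ≤ k`.
steiner-unique : ∀ {v t k} → t ≤ k → (C : Collection v) → List.All (P k) C → (∀ A → P t A → degree A C ≤ 1) → Unique C
steiner-unique _ [] _ _ = []
steiner-unique {t = t} {k} t≤k (B ∷ C) (size ∷ sizes) steiner =
  List.tabulate (λ {B′} B′∈C B≡B′ → let A , a , c = sub-of-size t B (≤-trans t≤k (≤-reflexive (sym size))) in
    <⇒≱ (s≤s (degree-∈ c (subst (_∈ C) (sym B≡B′) B′∈C)))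
      (subst (_≤ 1) (trans (degree-∷ A B C) (cong (λ b → 𝟙 b + degree A C) c)) (steiner A a)))
  ∷ steiner-unique t≤k C sizes (λ A a → ≤-trans (≤-trans (m≤n+m _ (𝟙 (contains A B)))
      (≤-reflexive (sym (degree-∷ A B C)))) (steiner A a))

-- The sum of `F` over the sets obtained from `A` by adding one element outside `A`.
∑-insert : ∀ {v} → Subset v → (Subset v → ℕ) → ℕ
∑-insert [] F = 0
∑-insert (true ∷ A) F = ∑-insert A (F ∘ (true ∷_))
∑-insert (false ∷ A) F = F (true ∷ A) + ∑-insert A (F ∘ (false ∷_))

∑-insert-cong : ∀ {v} (A : Subset v) {F G} → (∀ A′ → ∣ A′ ∣ ≡ suc ∣ A ∣ → F A′ ≡ G A′) → ∑-insert A F ≡ ∑-insert A G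
∑-insert-cong [] e = refl
∑-insert-cong (true ∷ A) e = ∑-insert-cong A (λ A′ a → e (true ∷ A′) (cong suc a))
∑-insert-cong (false ∷ A) e = cong₂ _+_ (e (true ∷ A) refl) (∑-insert-cong A (λ A′ a → e (false ∷ A′) a))

∑-insert-0 : ∀ {v} (A : Subset v) {F} → (∀ A′ → F A′ ≡ 0) → ∑-insert A F ≡ 0
∑-insert-0 [] e = refl
∑-insert-0 (true ∷ A) e = ∑-insert-0 A (e ∘ (true ∷_))
∑-insert-0 (false ∷ A) e = cong₂ _+_ (e _) (∑-insert-0 A (e ∘ (false ∷_)))

∑-insert-+ : ∀ {v} (A : Subset v) F G → ∑-insert A (λ A′ → F A′ + G A′) ≡ ∑-insert A F + ∑-insert A G
∑-insert-+ [] F G = refl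
∑-insert-+ (true ∷ A) F G = ∑-insert-+ A (F ∘ (true ∷_)) (G ∘ (true ∷_))
∑-insert-+ (false ∷ A) F G = trans (cong (F (true ∷ A) + G (true ∷ A) +_)
    (∑-insert-+ A (F ∘ (false ∷_)) (G ∘ (false ∷_))))
  (+-interchange (F (true ∷ A)) _ _ _)

-- A block `B` containing `A` contains `∣ B ∣ - ∣ A ∣` of the enlarged sets, any other block none;
-- the subtracted term stands on the left.
count-insert : ∀ {v} (A B : Subset v) →
  ∑-insert A (λ A′ → 𝟙 (contains A′ B)) + ∣ A ∣ * 𝟙 (contains A B) ≡ ∣ B ∣ * 𝟙 (contains A B)
count-insert [] [] = refl
count-insert (true ∷ A) (true ∷ B) = trans (ar (∑-insert A (λ A′ → 𝟙 (contains A′ B))) ∣ A ∣ (𝟙 (contains A B)))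
  (cong (𝟙 (contains A B) +_) (count-insert A B))
  where
  ar : ∀ E a c → E + (c + a * c) ≡ c + (E + a * c)
  ar = solve-∀
count-insert (true ∷ A) (false ∷ B) = trans (cong₂ _+_ (∑-insert-0 A (λ _ → refl)) (*-zeroʳ ∣ A ∣))
    (sym (*-zeroʳ ∣ B ∣))
count-insert (false ∷ A) (true ∷ B) = trans (+-assoc (𝟙 (contains A B)) _ _)
    (cong (𝟙 (contains A B) +_) (count-insert A B))
count-insert (false ∷ A) (false ∷ B) = count-insert A B

∑-insert-degree : ∀ {v k} (A : Subset v) (C : Collection v) → List.All (P k) C →
  ∑-insert A (λ A′ → degree A′ C) + ∣ A ∣ * degree A C ≡ k * degree A C
∑-insert-degree {k = k} A [] [] = trans (cong₂ _+_ (∑-insert-0 A (λ _ → refl)) (*-zeroʳ ∣ A ∣)) (sym (*-zeroʳ k))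
∑-insert-degree {k = k} A (B ∷ C) (refl ∷ sizes) = begin
  ∑-insert A (λ A′ → degree A′ (B ∷ C)) + ∣ A ∣ * degree A (B ∷ C)
    ≡⟨ cong₂ (λ E d → E + ∣ A ∣ * d) (trans (∑-insert-cong A (λ A′ _ → degree-∷ A′ B C)) (∑-insert-+ A _ _))
        (degree-∷ A B C) ⟩
  (E₁ + E₂) + ∣ A ∣ * (c + d)
    ≡⟨ ar E₁ E₂ ∣ A ∣ c d ⟩
  (E₁ + ∣ A ∣ * c) + (E₂ + ∣ A ∣ * d)
    ≡⟨ cong₂ _+_ (count-insert A B) (∑-insert-degree A C sizes) ⟩
  k * c + k * d
    ≡⟨ *-distribˡ-+ k c d ⟨
  k * (c + d)
    ≡⟨ cong (k *_) (degree-∷ A B C) ⟨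
  k * degree A (B ∷ C) ∎
  where
  open ≡-Reasoning
  c = 𝟙 (contains A B)
  d = degree A C
  E₁ = ∑-insert A (λ A′ → 𝟙 (contains A′ B))
  E₂ = ∑-insert A (λ A′ → degree A′ C)
  ar : ∀ E₁ E₂ a c d → (E₁ + E₂) + a * (c + d) ≡ (E₁ + a * c) + (E₂ + a * d)
  ar = solve-∀

module _ {t k v} (t≤k : t ≤ k) (T : Trade t k v) where
  open Trade T

  -- Induction on `d`, the distance of `∣ A ∣` from `t`. The degrees of the sets with one more
  -- element add up to `k - ∣ A ∣` times the degree of `A`, and this factor, `suc m`, is positive
  -- because `∣ A ∣ < t ≤ k`.
  balanced-below : ∀ d A → ∣ A ∣ + d ≡ t → degree A T₁ ≡ degree A T₂
  balanced-below zero A e = balanced A (trans (sym (+-identityʳ _)) e)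
  balanced-below (suc d) A e with m , k≡ ← m≤n⇒∃[o]m+o≡n
      (≤-trans (≤-trans (m≤m+n (suc ∣ A ∣) d) (≤-reflexive (trans (sym (+-suc ∣ A ∣ d)) e))) t≤k) =
    *-cancelˡ-≡ _ _ (suc m) (trans (sym (top T₁ blocks₁))
      (trans (∑-insert-cong A (λ A′ a → balanced-below d A′
          (trans (cong (_+ d) a) (trans (sym (+-suc ∣ A ∣ d)) e)))) (top T₂ blocks₂)))
    where
    ar : ∀ a m x → suc (a + m) * x ≡ suc m * x + a * x
    ar = solve-∀
    top : ∀ C → List.All (P k) C → ∑-insert A (λ A′ → degree A′ C) ≡ suc m * degree A C
    top C sizes = +-cancelʳ-≡ (∣ A ∣ * degree A C) _ _
        (trans (∑-insert-degree A C sizes) (trans (cong (_* degree A C) (sym k≡)) (ar ∣ A ∣ m (degree A C))))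

  balanced-≤ : ∀ A → ∣ A ∣ ≤ t → degree A T₁ ≡ degree A T₂
  balanced-≤ A A≤t = let d , e = m≤n⇒∃[o]m+o≡n A≤t in balanced-below d A e

  length-T₂ : length T₁ ≡ length T₂
  length-T₂ = trans (sym (degree-𝟎 T₁)) (trans (balanced-≤ 𝟎 (≤-trans (≤-reflexive (∣𝟎∣ v)) z≤n)) (degree-𝟎 T₂))

  trade-code : I (suc t) (word (T₁ ++ T₂))
  trade-code = I-contains (suc t) λ A A<1+t → trans (par-word (T₁ ++ T₂) A)
    (trans (cong odd (trans (degree-++ A T₁ T₂) (cong (_+ degree A T₂) (balanced-≤ A (≤-pred A<1+t)))))
      (trans (odd-+ (degree A T₂) _) (xor-same (odd (degree A T₂)))))

  wt-trade : IsSteiner T → wt (word (T₁ ++ T₂)) ≡ 2 * volume T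
  wt-trade steiner = trans (wt-word (++⁺ (steiner-unique t≤k T₁ blocks₁ (λ A a → proj₁ (steiner A a)))
      (steiner-unique t≤k T₂ blocks₂ (λ A a → proj₂ (steiner A a))) disjoint))
    (trans (length-++ T₁) (cong (length T₁ +_) (trans (sym length-T₂) (sym (+-identityʳ _)))))

  volume-gap : IsSteiner T → 0 < volume T → volume T < 2 ^ suc t → ∃[ e ] 2 * volume T + 2 ^ e ≡ 2 * 2 ^ suc t
  volume-gap steiner pos light =
    let p , fp = wt-pos {f = word (T₁ ++ T₂)} (≤-trans (≤-trans pos (m≤m+n _ _)) (≤-reflexive (sym (wt-trade steiner))))
        e , gap = weight-gap (suc t) trade-code fp (≤-<-trans (≤-reflexive (wt-trade steiner)) (*-monoʳ-< 2 light))
    in e , trans (cong (_+ 2 ^ e) (sym (wt-trade steiner))) gap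

-- Arithmetic of the gaps

between-powers : ∀ j e → 2 ^ j < 2 ^ e → 2 ^ e < 2 * 2 ^ j → ⊥
between-powers j e lo hi = <⇒≱ hi (power-< (j , refl) (e , refl) lo)

-- Since `2 ^ e` is twice `Q - m`, the bounds place it strictly between `2 ^ (j + 1)` and
-- `2 ^ (j + 2)`.
gap-excludes : ∀ {j e m Q} → Q < m + 2 ^ suc j → m + 2 ^ j < Q → 2 * m + 2 ^ e ≡ 2 * Q → ⊥
gap-excludes {j} {e} {m} {Q} lo hi eq = between-powers (suc j) e
  (lin≤ 1 (+-mono-≤ (*-monoʳ-≤ 2 hi) (≤-reflexive (sym eq))) (i₁ m (2 ^ j) (2 ^ e) Q))
  (lin≤ 1 (+-mono-≤ (*-monoʳ-≤ 2 lo) (≤-reflexive eq)) (i₂ m (2 ^ j) (2 ^ e) Q))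
  where
  i₁ : ∀ m p E Q → suc (2 * p) + (2 * Q + (2 * m + E)) + 1 ≡ E + (2 * suc (m + p) + 2 * Q)
  i₁ = solve-∀
  i₂ : ∀ m p E Q → suc E + (2 * (m + 2 * p) + 2 * Q) + 1 ≡ 2 * (2 * p) + (2 * suc Q + (2 * m + E))
  i₂ = solve-∀

mainTheorem2 : ∀ (t k v : ℕ) → 0 < t → t < k → k < v →
    ∀ (i : ℕ) → i < t →
    ∀ (s : ℕ) → s[ t , i ] < s → s < s[ t , i + 1 ] →
    ¬ (Σ[ T ∈ Trade t k v ] (IsSteiner T × volume T ≡ s))
mainTheorem2 t k v _ t<k _ i i<t s lo hi (T , steiner , refl) =
  -- With `j` for `t ∸ (i + 1)`, the two ends of the interval are `Q ∸ 2 ^ suc j` and `Q ∸ 2 ^ j`;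
  -- the first form uses `i < t`, by which `t ∸ i` is `suc j`.
  gap-excludes {t ∸ (i + 1)} {proj₁ gap} {s} {Q}
    (begin-strict
      Q                          ≤⟨ m≤n+m∸n Q (2 ^ suc (t ∸ (i + 1))) ⟩
      2 ^ suc (t ∸ (i + 1)) + (Q ∸ 2 ^ suc (t ∸ (i + 1))) <⟨ +-monoʳ-< (2 ^ suc (t ∸ (i + 1))) lo′ ⟩
      2 ^ suc (t ∸ (i + 1)) + s  ≡⟨ +-comm _ s ⟩
      s + 2 ^ suc (t ∸ (i + 1))  ∎)
    (begin-strict
      s + 2 ^ (t ∸ (i + 1))                                  <⟨ +-monoˡ-< (2 ^ (t ∸ (i + 1))) hi′ ⟩
      Q ∸ 2 ^ (t ∸ (i + 1)) + 2 ^ (t ∸ (i + 1))              ≡⟨ m∸n+n≡m (^-monoʳ-≤ 2 (m≤n⇒m≤1+n (m∸n≤m t (i + 1)))) ⟩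
      Q                                                      ∎)
    (proj₂ gap)
  where
  open ≤-Reasoning
  Q : ℕ
  Q = 2 ^ suc t
  lo′ : Q ∸ 2 ^ suc (t ∸ (i + 1)) < s
  lo′ = subst₂ (λ a b → 2 ^ a ∸ 2 ^ b < s) (+-comm t 1)
    (trans (+-∸-assoc 1 i<t) (cong (λ a → suc (t ∸ a)) (+-comm 1 i))) lo
  hi′ : s < Q ∸ 2 ^ (t ∸ (i + 1))
  hi′ = subst (λ a → s < 2 ^ a ∸ 2 ^ (t ∸ (i + 1))) (+-comm t 1) hi
  gap : ∃[ e ] 2 * volume T + 2 ^ e ≡ 2 * Q
  gap = volume-gap (<⇒≤ t<k) T steiner (≤-<-trans z≤n lo′) (<-≤-trans hi′ (m∸n≤m Q (2 ^ (t ∸ (i + 1)))))
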